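{- For $k\ge i\ge1$, \[ \sum_{N_1\ge\cdots\ge N_{k-1}\ge0}\frac{(-q^{2-2N_1};q^2)_{N_1-1}(-q^{1-2N_1};q^2)_{N_1}\,q^{2(N_1^2+\cdots+N_{k-1}^2+N_{i+1}+\cdots+N_{k-1})}(1+q^{2N_i})}{(q^2;q^2)_{N_1-N_2}\cdots(q^2;q^2)_{N_{k-2}-N_{k-1}}(q^2;q^2)_{N_{k-1}}} =\frac{(-q;q)_\infty\,(q^{2i-1},q^{4k-1-2i},q^{4k-2};q^{4k-2})_\infty}{(q;q)_\infty}. \]
   Context: $(a;q)_\infty=\prod_{j\ge0}(1-aq^j)$, $(a;q)_n=(a;q)_\infty/(aq^n;q)_\infty$ for every integer $n$, and $(a_1,\dots,a_m;q)_\infty=(a_1;q)_\infty\cdots(a_m;q)_\infty$. The sum runs over integer tuples $(N_1,\dots,N_{k-1})$ with $N_1\ge\cdots\ge N_{k-1}\ge0$; empty sums are $0$, and in the case $i=k$ one sets $N_k=0$. -}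

module Defs where

open import Data.Nat as ℕ using (ℕ; zero; suc; _∸_; _⊔_; _≡ᵇ_; _<ᵇ_)
open import Data.Nat.DivMod using (_%_; _/_)
open import Data.Integer as ℤ using (ℤ; +_; -[1+_])
open import Data.Rational as ℚ using (ℚ; 0ℚ; 1ℚ; _≟_; 1/_; ≢-nonZero)
open import Data.List using (List; []; _∷_; map; foldr; upTo; concatMap; drop)
open import Data.Nat.ListAction using (sum)
open import Data.Bool using (if_then_else_)
open import Relation.Nullary using (yes; no)

-- Formal power series with rational coefficients: n ↦ coefficient of q^n

FPS : Set
FPS = ℕ → ℚ

sumBelow : (ℕ → ℚ) → ℕ → ℚ
sumBelow f zero    = 0ℚ
sumBelow f (suc n) = sumBelow f n ℚ.+ f n

zeroF : FPS
zeroF _ = 0ℚ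

oneF : FPS
oneF n = if n ≡ᵇ 0 then 1ℚ else 0ℚ

_+F_ : FPS → FPS → FPS
(f +F g) n = f n ℚ.+ g n

_*F_ : FPS → FPS → FPS
(f *F g) n = sumBelow (λ j → f j ℚ.* g (n ∸ j)) (suc n)

scaleF : ℚ → FPS → FPS
scaleF c f n = c ℚ.* f n

shiftF : ℕ → FPS → FPS
shiftF k f n = if n <ᵇ k then 0ℚ else f (n ∸ k)

prodF : List FPS → FPS
prodF = foldr _*F_ oneF

powQ : ℚ → ℕ → ℚ
powQ c zero    = 1ℚ
powQ c (suc m) = c ℚ.* powQ c m

-- reciprocal in ℚ (junk value 0 at 0; never used at 0 below)
recip : ℚ → ℚ
recip p with p ≟ 0ℚ
... | yes _  = 0ℚ
... | no p≢0 = 1/_ p {{≢-nonZero p≢0}}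

-- Multiplicative inverse of a power series with constant term 1
-- (g 0 = 1, g n = - Σ_{j=1}^{n} f j * g (n - j)); only applied to such series.
invUpto : FPS → ℕ → FPS
invUpto f zero    = oneF
invUpto f (suc n) = λ m → if m ≡ᵇ suc n
  then ℚ.- sumBelow (λ j → f (suc j) ℚ.* h (n ∸ j)) (suc n)
  else h m
  where h = invUpto f n

invF : FPS → FPS
invF f n = invUpto f n n

-- Formal Laurent series with finitely many negative powers:
-- laurent d f stands for q^(-d) * f

record Laurent : Set where
  constructor laurent
  field
    negDeg : ℕ
    series : FPS
open Laurent public

coeffL : Laurent → ℤ → ℚ
coeffL (laurent d f) z with z ℤ.+ (+ d)
... | + m      = f m
... | -[1+ _ ] = 0ℚ

ofFPS : FPS → Laurent
ofFPS f = laurent 0 f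

oneL : Laurent
oneL = ofFPS oneF

_+L_ : Laurent → Laurent → Laurent
laurent d₁ f +L laurent d₂ g =
  laurent (d₁ ⊔ d₂) (shiftF ((d₁ ⊔ d₂) ∸ d₁) f +F shiftF ((d₁ ⊔ d₂) ∸ d₂) g)

_*L_ : Laurent → Laurent → Laurent
laurent d₁ f *L laurent d₂ g = laurent (d₁ ℕ.+ d₂) (f *F g)

prodL : List Laurent → Laurent
prodL = foldr _*L_ oneL

sumL : List Laurent → Laurent
sumL = foldr _+L_ (ofFPS zeroF)

monoL : ℚ → ℤ → Laurent
monoL c (+ m)      = ofFPS (λ n → if n ≡ᵇ m then c else 0ℚ)
monoL c -[1+ m ]   = laurent (suc m) (λ n → if n ≡ᵇ 0 then c else 0ℚ)

binL : ℚ → ℤ → Laurent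
binL c s = oneL +L monoL (ℚ.- c) s

-- the inverse of the binomial 1 - c q^s (as a Laurent series, expanded in
-- the q-adic topology); for s = 0 this needs c ≠ 1, for s < 0 it needs c ≠ 0.
invBinL : ℚ → ℤ → Laurent
invBinL c (+ zero)  = ofFPS (λ n → if n ≡ᵇ 0 then recip (1ℚ ℚ.- c) else 0ℚ)
invBinL c (+ suc r) =
  ofFPS (λ n → if n % suc r ≡ᵇ 0 then powQ c (n / suc r) else 0ℚ)
-- 1 - c q^(-(r+1)) = -c q^(-(r+1)) (1 - c⁻¹ q^(r+1))
invBinL c -[1+ r ]  =
  ofFPS (scaleF (ℚ.- recip c)
          (shiftF (suc r)
            (λ n → if n % suc r ≡ᵇ 0 then powQ (recip c) (n / suc r) else 0ℚ)))

-- q-Pochhammer (a;p)_n for a = c q^e, p = q^b, and any integer n, following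
-- (a;p)_n = (a;p)_∞ / (a p^n;p)_∞, i.e.
--   n ≥ 0 :  ∏_{j=0}^{n-1} (1 - a p^j)
--   n < 0 :  1 / ∏_{j=1}^{-n} (1 - a p^{-j})
qPoch : ℚ → ℤ → ℕ → ℤ → Laurent
qPoch c e b (+ m)    = prodL (map (λ j → binL c (e ℤ.+ + (b ℕ.* j))) (upTo m))
qPoch c e b -[1+ m ] =
  prodL (map (λ j → invBinL c (e ℤ.- + (b ℕ.* suc j))) (upTo (suc m)))

binF : ℚ → ℕ → FPS
binF c s = oneF +F (λ n → if n ≡ᵇ s then ℚ.- c else 0ℚ)

qPochF : ℚ → ℕ → ℕ → ℕ → FPS
qPochF c e b m = prodF (map (λ j → binF c (e ℕ.+ b ℕ.* j)) (upTo m))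

-- infinite q-Pochhammer (c q^e; q^b)_∞ for e ≥ 1, b ≥ 1: the coefficient of
-- q^n only involves the factors with e + b j ≤ n, hence j ≤ n.
qPochInf : ℚ → ℕ → ℕ → FPS
qPochInf c e b n = qPochF c e b (suc n) n

decTuples : ℕ → ℕ → List (List ℕ)
decTuples zero    M = [] ∷ []
decTuples (suc n) M =
  concatMap (λ a → map (a ∷_) (decTuples n a)) (upTo (suc M))

-- 1-based lookup, with value 0 beyond the end (so N_k = 0 for a tuple
-- (N₁,…,N_{k-1}))
nth : List ℕ → ℕ → ℕ
nth []       _             = 0
nth (x ∷ xs) zero          = 0
nth (x ∷ xs) (suc zero)    = x
nth (x ∷ xs) (suc (suc j)) = nth xs (suc j)

-ℚ1 : ℚ
-ℚ1 = ℚ.- 1ℚ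

summand : ℕ → ℕ → List ℕ → Laurent
summand k i Ns =
  qPoch -ℚ1 (+ 2 ℤ.- + (2 ℕ.* N₁)) 2 (+ N₁ ℤ.- + 1)
  *L (qPoch -ℚ1 (+ 1 ℤ.- + (2 ℕ.* N₁)) 2 (+ N₁)
  *L (monoL 1ℚ (+ (2 ℕ.* (sum (map (λ x → x ℕ.* x) Ns) ℕ.+ sum (drop i Ns))))
  *L ((oneL +L monoL 1ℚ (+ (2 ℕ.* nth Ns i)))
  *L ofFPS (prodF (map (λ j → invF (qPochF 1ℚ 2 2 (nth Ns j ∸ nth Ns (suc j))))
                       (map suc (upTo (k ∸ 1))))))))
  where N₁ = nth Ns 1

partialLHS : ℕ → ℕ → ℕ → Laurent
partialLHS k i M = sumL (map (summand k i) (decTuples (k ∸ 1) M))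

RHS : ℕ → ℕ → FPS
RHS k i =
  qPochInf -ℚ1 1 1
  *F (qPochInf 1ℚ (2 ℕ.* i ∸ 1) (4 ℕ.* k ∸ 2)
  *F (qPochInf 1ℚ (4 ℕ.* k ∸ 1 ∸ 2 ℕ.* i) (4 ℕ.* k ∸ 2)
  *F (qPochInf 1ℚ (4 ℕ.* k ∸ 2) (4 ℕ.* k ∸ 2)
  *F invF (qPochInf 1ℚ 1 1))))

{-# OPTIONS --safe #-}
-- Put p = q².  Clearing negative powers of q, the sum over N₁ carries the weight
-- w N₁ = (-1;q)_{2N₁} q^{N₁} / 2, and what is left is obtained from the unit Bailey pair relative
-- to a = p by k - i Bailey steps, multiplication by 1 + p^N (which turns a Bailey pair relative to
-- a = p into one relative to a = 1), and i - 1 further Bailey steps.  The last sum is the q-Gauss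
-- sum with ρ₁ = -1, ρ₂ = -q in base p, which telescopes in the Bailey index r up to a constant.
-- So, modulo a high power of q, the left-hand side is a constant C, independent of k and i, times
-- Σ_n (-1)^n q^{(2k-1)n² + (2k-2i)n}, which is a theta product by Jacobi's triple product.  For
-- k = i = 1 the left-hand side is 1, and this determines C.
--
-- The identities hold in any commutative ring with an element q such that 2 and all 1 - q^(n+1)
-- are invertible, limits being replaced by congruences modulo q^M.
module Submission where

-- Write N for N₁. Reversing the two numerator products extracts q^(-N(N-1)) and q^(-N²); against
-- q^(2N²) only q^N survives, and what remains is (-q²;q²)_{N-1} (-q;q²)_N = (-1;q)_{2N} / 2. At N =
-- 0 the factor 1/2 is the symbol of index -1. Since (-1;p)_N (-q;p)_N = (-1;q)_{2N} and p/(ρ₁ρ₂) =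
-- q for ρ₁ = -1, ρ₂ = -q, this is the weight of Bailey's lemma with these two parameters finite, so
-- the chain ends in a q-Gauss sum and not in one more step of the other kind. This weight has order
-- only q^N, so cutting the sum off at N₁ ≤ M is exact only modulo q^(M+1). Every limit is therefore
-- a finite identity with an explicit remainder, and upper limits have to be followed exactly
-- through each interchange of sums. The constant C is itself such a limit. It disappears by
-- cross-multiplication: the multisum for (k, i) times the theta series for (1, 1) is congruent to
-- the theta series for (k, i). The theta series for (1, 1) is never inverted; its product form is
-- absorbed into (q;q)_∞.

open import Defs
open import Algebra.Bundles using (CommutativeRing)
import Algebra.Solver.Ring
open import Algebra.Solver.Ring.AlmostCommutativeRing using (fromCommutativeRing; _-Raw-AlmostCommutative⟶_)
open import Data.Bool using (true; false; if_then_else_)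
open import Data.Integer as ℤ using (ℤ; +_; -[1+_])
import Data.Integer.Properties as ℤ
open import Data.List using (List; []; _∷_; _++_; _∷ʳ_; length; map; concatMap; drop; applyUpTo; upTo)
import Data.List.Properties as List
open import Data.List.Relation.Unary.All as All using (All; []; _∷_)
import Data.List.Relation.Unary.All.Properties as All
open import Data.Maybe using (Maybe; just; nothing)
open import Data.Nat as ℕ using (ℕ; zero; suc; _∸_; _≡ᵇ_; _⊔_; _≤_)
open import Data.Nat.ListAction using (sum)
import Data.Nat.Properties as ℕ
open import Data.Nat.Tactic.RingSolver using (solve-∀)
open import Data.Product using (∃-syntax; _,_)
open import Data.Rational as ℚ using (ℚ; 0ℚ; 1ℚ; ½)
import Data.Rational.Properties as ℚ
import Level
open import Relation.Binary.PropositionalEquality as ≡ using (_≡_)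
open import Relation.Nullary using (yes; no; contradiction)

-- Algebra.Solver.Ring over an arbitrary commutative ring needs coefficients with decidable
-- equality: the integers.
module IntegerSolver {c ℓ} (R : CommutativeRing c ℓ) where
  open CommutativeRing R
  open import Algebra.Properties.Ring ring using (-‿distribˡ-*; -‿distribʳ-*)
  open import Algebra.Properties.AbelianGroup +-abelianGroup using (⁻¹-∙-comm; ⁻¹-involutive; ε⁻¹≈ε)
  open import Algebra.Properties.Semiring.Mult.TCOptimised semiring using (_×_; 1+×; ×-homo-+; ×1-homo-*)
  open import Relation.Binary.Reasoning.Setoid setoid

  -- With the type-checking-optimised multiples, `1 × 1#` is `1#` by definition, so the numeral 1 in
  -- solver goals leaves no stray `+ 0#`.
  ⟦_⟧ℤ : ℤ → Carrier
  ⟦ + n ⟧ℤ      = n × 1#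
  ⟦ -[1+ n ] ⟧ℤ = - (suc n × 1#)

  cancel-suc : ∀ x y → (1# + x) - (1# + y) ≈ x - y
  cancel-suc x y = begin
    (1# + x) - (1# + y)       ≈⟨ +-congˡ (sym (⁻¹-∙-comm 1# y)) ⟩
    (1# + x) + (- 1# - y)     ≈⟨ +-congʳ (+-comm 1# x) ⟩
    (x + 1#) + (- 1# - y)     ≈⟨ +-assoc x 1# _ ⟩
    x + (1# + (- 1# - y))     ≈⟨ +-congˡ (+-assoc 1# (- 1#) (- y)) ⟨
    x + ((1# - 1#) - y)       ≈⟨ +-congˡ (+-congʳ (-‿inverseʳ 1#)) ⟩
    x + (0# - y)              ≈⟨ +-congˡ (+-identityˡ (- y)) ⟩
    x - y                     ∎

  ⊖-homo : ∀ m n → ⟦ m ℤ.⊖ n ⟧ℤ ≈ m × 1# - n × 1#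
  ⊖-homo m zero = sym (trans (+-congˡ ε⁻¹≈ε) (+-identityʳ _))
  ⊖-homo zero (suc n) = sym (+-identityˡ _)
  ⊖-homo (suc m) (suc n) = begin
    ⟦ suc m ℤ.⊖ suc n ⟧ℤ                ≡⟨ ≡.cong ⟦_⟧ℤ (ℤ.[1+m]⊖[1+n]≡m⊖n m n) ⟩
    ⟦ m ℤ.⊖ n ⟧ℤ                        ≈⟨ ⊖-homo m n ⟩
    m × 1# - n × 1#                     ≈⟨ cancel-suc _ _ ⟨
    (1# + m × 1#) - (1# + n × 1#)       ≈⟨ +-cong (1+× m 1#) (-‿cong (1+× n 1#)) ⟨
    suc m × 1# - suc n × 1#             ∎

  ℤ-+-homo : ∀ i j → ⟦ i ℤ.+ j ⟧ℤ ≈ ⟦ i ⟧ℤ + ⟦ j ⟧ℤ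
  ℤ-+-homo (+ m) (+ n) = ×-homo-+ 1# m n
  ℤ-+-homo (+ m) -[1+ n ] = ⊖-homo m (suc n)
  ℤ-+-homo -[1+ m ] (+ n) = trans (⊖-homo n (suc m)) (+-comm _ _)
  ℤ-+-homo -[1+ m ] -[1+ n ] = begin
    - (suc (suc (m ℕ.+ n)) × 1#)        ≡⟨ ≡.cong (λ t → - (suc t × 1#)) (≡.sym (ℕ.+-suc m n)) ⟩
    - ((suc m ℕ.+ suc n) × 1#)          ≈⟨ -‿cong (×-homo-+ 1# (suc m) (suc n)) ⟩
    - (suc m × 1# + suc n × 1#)         ≈⟨ ⁻¹-∙-comm _ _ ⟨
    - (suc m × 1#) - suc n × 1#         ∎

  ℤ-neg-homo : ∀ i → ⟦ ℤ.- i ⟧ℤ ≈ - ⟦ i ⟧ℤ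
  ℤ-neg-homo (+ zero)  = sym ε⁻¹≈ε
  ℤ-neg-homo (+ suc n) = refl
  ℤ-neg-homo -[1+ n ]  = sym (⁻¹-involutive _)

  ℤ-*-homo : ∀ i j → ⟦ i ℤ.* j ⟧ℤ ≈ ⟦ i ⟧ℤ * ⟦ j ⟧ℤ
  ℤ-*-homo (+ m) (+ n) = trans (reflexive (≡.cong ⟦_⟧ℤ (ℤ.+◃n≡+n (m ℕ.* n)))) (×1-homo-* m n)
  ℤ-*-homo (+ m) -[1+ n ] = begin
    ⟦ + m ℤ.* -[1+ n ] ⟧ℤ               ≡⟨ ≡.cong ⟦_⟧ℤ (ℤ.-◃n≡-n (m ℕ.* suc n)) ⟩
    ⟦ ℤ.- + (m ℕ.* suc n) ⟧ℤ            ≈⟨ ℤ-neg-homo (+ (m ℕ.* suc n)) ⟩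
    - ((m ℕ.* suc n) × 1#)              ≈⟨ -‿cong (×1-homo-* m (suc n)) ⟩
    - (m × 1# * (suc n × 1#))           ≈⟨ -‿distribʳ-* _ _ ⟩
    m × 1# * (- (suc n × 1#))           ∎
  ℤ-*-homo -[1+ m ] (+ n) = begin
    ⟦ -[1+ m ] ℤ.* + n ⟧ℤ               ≡⟨ ≡.cong ⟦_⟧ℤ (ℤ.-◃n≡-n (suc m ℕ.* n)) ⟩
    ⟦ ℤ.- + (suc m ℕ.* n) ⟧ℤ            ≈⟨ ℤ-neg-homo (+ (suc m ℕ.* n)) ⟩
    - ((suc m ℕ.* n) × 1#)              ≈⟨ -‿cong (×1-homo-* (suc m) n) ⟩
    - (suc m × 1# * (n × 1#))           ≈⟨ -‿distribˡ-* _ _ ⟩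
    (- (suc m × 1#)) * (n × 1#)         ∎
  ℤ-*-homo -[1+ m ] -[1+ n ] = begin
    (suc m ℕ.* suc n) × 1#              ≈⟨ ×1-homo-* (suc m) (suc n) ⟩
    suc m × 1# * (suc n × 1#)           ≈⟨ ⁻¹-involutive _ ⟨
    - - (suc m × 1# * (suc n × 1#))     ≈⟨ -‿cong (-‿distribˡ-* _ _) ⟩
    - ((- (suc m × 1#)) * (suc n × 1#)) ≈⟨ -‿distribʳ-* _ _ ⟩
    (- (suc m × 1#)) * (- (suc n × 1#)) ∎

  ℤ-morphism : ℤ.+-*-rawRing -Raw-AlmostCommutative⟶ fromCommutativeRing R
  ℤ-morphism = record
    { ⟦_⟧ = ⟦_⟧ℤ ; +-homo = ℤ-+-homo ; *-homo = ℤ-*-homo ; -‿homo = ℤ-neg-homo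
    ; 0-homo = refl ; 1-homo = refl }

  ℤ-weaklyDecidable : ∀ i j → Maybe (⟦ i ⟧ℤ ≈ ⟦ j ⟧ℤ)
  ℤ-weaklyDecidable i j with i ℤ.≟ j
  ... | yes i≡j = just (reflexive (≡.cong ⟦_⟧ℤ i≡j))
  ... | no _    = nothing

  open Algebra.Solver.Ring ℤ.+-*-rawRing (fromCommutativeRing R) ℤ-morphism ℤ-weaklyDecidable public
    using (Polynomial; solve; _:=_; con; _:+_; _:*_; _:-_; :-_)

  :1 : ∀ {n} → Polynomial n
  :1 = con (+ 1)

-- Sums over antidiagonals.

module Antidiagonal {c ℓ} (R : CommutativeRing c ℓ) where
  open CommutativeRing R
  open import Relation.Binary.Reasoning.Setoid setoid
  open import Algebra.Properties.CommutativeSemigroup +-commutativeSemigroup using (interchange)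

  -- anti f N = Σ_{j+l=N} f j l; avoids truncated subtraction in the second index.
  anti : (ℕ → ℕ → Carrier) → ℕ → Carrier
  anti f zero    = f 0 0
  anti f (suc N) = f 0 (suc N) + anti (λ j l → f (suc j) l) N

  anti-cong′ : ∀ {f g} N → (∀ j l → j ℕ.+ l ≡ N → f j l ≈ g j l) → anti f N ≈ anti g N
  anti-cong′ zero    h = h 0 0 ≡.refl
  anti-cong′ (suc N) h = +-cong (h 0 (suc N) ≡.refl) (anti-cong′ N (λ j l e → h (suc j) l (≡.cong suc e)))

  anti-cong : ∀ {f g} N → (∀ j l → f j l ≈ g j l) → anti f N ≈ anti g N
  anti-cong N h = anti-cong′ N (λ j l _ → h j l)

  anti-snoc : ∀ f N → anti f (suc N) ≈ anti (λ j l → f j (suc l)) N + f (suc N) 0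
  anti-snoc f zero    = refl
  anti-snoc f (suc N) = trans (+-congˡ (anti-snoc (λ j l → f (suc j) l) N)) (sym (+-assoc _ _ _))

  anti-+ : ∀ f g N → anti (λ j l → f j l + g j l) N ≈ anti f N + anti g N
  anti-+ f g zero    = refl
  anti-+ f g (suc N) = trans (+-congˡ (anti-+ _ _ N)) (interchange _ _ _ _)

  anti-*ˡ : ∀ x f N → x * anti f N ≈ anti (λ j l → x * f j l) N
  anti-*ˡ x f zero    = refl
  anti-*ˡ x f (suc N) = trans (distribˡ _ _ _) (+-congˡ (anti-*ˡ x _ N))

  anti-*ʳ : ∀ x f N → anti f N * x ≈ anti (λ j l → f j l * x) N
  anti-*ʳ x f zero    = refl
  anti-*ʳ x f (suc N) = trans (distribʳ _ _ _) (+-congˡ (anti-*ʳ x _ N))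

  anti-zero : ∀ N → anti (λ _ _ → 0#) N ≈ 0#
  anti-zero zero    = refl
  anti-zero (suc N) = trans (+-identityˡ _) (anti-zero N)

  anti-swap : ∀ f N → anti f N ≈ anti (λ j l → f l j) N
  anti-swap f zero    = refl
  anti-swap f (suc N) = begin
    f 0 (suc N) + anti (λ j l → f (suc j) l) N  ≈⟨ +-congˡ (anti-swap _ N) ⟩
    f 0 (suc N) + anti (λ j l → f (suc l) j) N  ≈⟨ +-comm _ _ ⟩
    anti (λ j l → f (suc l) j) N + f 0 (suc N)  ≈⟨ anti-snoc (λ j l → f l j) N ⟨
    anti (λ j l → f l j) (suc N)                ∎

  -- Both sides run over the triples r + l + c = N. This is the interchange of sums behind every
  -- Bailey step, the final summation over N₁, and associativity of the Cauchy product.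
  anti-assoc : ∀ (f : ℕ → ℕ → ℕ → Carrier) N →
    anti (λ a c → anti (λ r l → f r l c) a) N ≈ anti (λ r b → anti (λ l c → f r l c) b) N
  anti-assoc f zero = refl
  anti-assoc f (suc N) = begin
    f 0 0 (suc N) + anti (λ a c → f 0 (suc a) c + anti (λ r l → f (suc r) l c) a) N
      ≈⟨ +-congˡ (anti-+ _ _ N) ⟩
    f 0 0 (suc N) + (anti (λ a c → f 0 (suc a) c) N + anti (λ a c → anti (λ r l → f (suc r) l c) a) N)
      ≈⟨ +-assoc _ _ _ ⟨
    anti (λ l c → f 0 l c) (suc N) + anti (λ a c → anti (λ r l → f (suc r) l c) a) N
      ≈⟨ +-congˡ (anti-assoc (λ r → f (suc r)) N) ⟩
    anti (λ l c → f 0 l c) (suc N) + anti (λ r b → anti (λ l c → f (suc r) l c) b) N ∎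

  -- Written as an antidiagonal sum that ignores its second index, so that `anti-assoc` also
  -- reorders double sums with an upper limit.
  sumTo : (ℕ → Carrier) → ℕ → Carrier
  sumTo f = anti (λ j _ → f j)

  sumTo-snoc : ∀ f N → sumTo f (suc N) ≈ sumTo f N + f (suc N)
  sumTo-snoc f N = anti-snoc (λ j _ → f j) N

-- Congruence modulo powers of q.

module PowerCongruence {c ℓ} (R : CommutativeRing c ℓ) (q : CommutativeRing.Carrier R) where
  open CommutativeRing R
  open Antidiagonal R
  open IntegerSolver R

  -- The powers of q (and everything built from them) are abstract so that unification never
  -- unfolds them; stdlib's _^_ would not be injective in its exponent.
  abstract
    q^ : ℕ → Carrier
    q^ zero    = 1#
    q^ (suc n) = q * q^ n

    q^-0 : q^ 0 ≈ 1#
    q^-0 = refl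

    q^-suc : ∀ n → q^ (suc n) ≈ q * q^ n
    q^-suc n = refl

    q^-+ : ∀ m n → q^ (m ℕ.+ n) ≈ q^ m * q^ n
    q^-+ zero    n = sym (*-identityˡ _)
    q^-+ (suc m) n = trans (*-congˡ (q^-+ m n)) (sym (*-assoc _ _ _))

  q^-cong : ∀ {m n} → m ≡ n → q^ m ≈ q^ n
  q^-cong e = reflexive (≡.cong q^ e)

  q^-1 : q^ 1 ≈ q
  q^-1 = trans (q^-suc 0) (trans (*-congˡ q^-0) (*-identityʳ q))

  infix 4 _≈_[mod_]
  infixr 4 _,_
  record _≈_[mod_] (x y : Carrier) (M : ℕ) : Set (c Level.⊔ ℓ) where
    constructor _,_
    field
      quotient : Carrier
      equation : x ≈ y + q^ M * quotient

  mod-of-≈ : ∀ {x y M} → x ≈ y → x ≈ y [mod M ]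
  mod-of-≈ e = 0# , trans e (sym (trans (+-congˡ (zeroʳ _)) (+-identityʳ _)))

  mod-refl : ∀ {x M} → x ≈ x [mod M ]
  mod-refl = mod-of-≈ refl

  mod-sym : ∀ {x y M} → x ≈ y [mod M ] → y ≈ x [mod M ]
  mod-sym {x} {y} {M} (d , e) = - d ,
    trans (solve 3 (λ y t d → y := (y :+ t :* d) :+ t :* (:- d)) refl y (q^ M) d) (+-congʳ (sym e))

  mod-trans : ∀ {x y z M} → x ≈ y [mod M ] → y ≈ z [mod M ] → x ≈ z [mod M ]
  mod-trans {x} {y} {z} {M} (d , e) (d′ , e′) = d′ + d ,
    trans e (trans (+-congʳ e′) (solve 4 (λ z t d d′ → (z :+ t :* d′) :+ t :* d := z :+ t :* (d′ :+ d)) refl z (q^ M) d d′))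

  mod-+ : ∀ {x x′ y y′ M} → x ≈ x′ [mod M ] → y ≈ y′ [mod M ] → x + y ≈ x′ + y′ [mod M ]
  mod-+ {x′ = x′} {y′ = y′} {M} (d , e) (d′ , e′) = d + d′ ,
    trans (+-cong e e′)
      (solve 5 (λ x y t d d′ → (x :+ t :* d) :+ (y :+ t :* d′) := (x :+ y) :+ t :* (d :+ d′)) refl x′ y′ (q^ M) d d′)

  mod-* : ∀ {x x′ y y′ M} → x ≈ x′ [mod M ] → y ≈ y′ [mod M ] → x * y ≈ x′ * y′ [mod M ]
  mod-* {x′ = x′} {y′ = y′} {M} (d , e) (d′ , e′) = d * y′ + x′ * d′ + d * (q^ M) * d′ ,
    trans (*-cong e e′)
      (solve 5 (λ x y t d d′ → (x :+ t :* d) :* (y :+ t :* d′) := x :* y :+ t :* (d :* y :+ x :* d′ :+ d :* t :* d′)) refl x′ y′ (q^ M) d d′)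

  mod-*ˡ : ∀ x {y y′ M} → y ≈ y′ [mod M ] → x * y ≈ x * y′ [mod M ]
  mod-*ˡ x = mod-* mod-refl

  mod-weaken : ∀ {x y M N} → M ℕ.≤ N → x ≈ y [mod N ] → x ≈ y [mod M ]
  mod-weaken {x} {y} {M} {N} M≤N (d , e) = q^ (N ∸ M) * d ,
    trans e (+-congˡ (trans (*-congʳ (trans (q^-cong (≡.sym (ℕ.m+[n∸m]≡n M≤N))) (q^-+ M (N ∸ M)))) (*-assoc _ _ _)))

  -- A factor divisible by `q^ K` raises the precision by K. In the triple product this makes up for
  -- the poor precision of the factorial quotients far from the middle term.
  mod-shift : ∀ {x y t M K N} → N ℕ.≤ K ℕ.+ M → t ≈ 0# [mod K ] → x ≈ y [mod M ] → t * x ≈ t * y [mod N ]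
  mod-shift {x} {y} {t} {M} {K} N≤ (s , t≈) (d , e) = mod-weaken N≤ (s * d , (begin
    t * x                                        ≈⟨ *-congˡ e ⟩
    t * (y + q^ M * d)                          ≈⟨ distribˡ _ _ _ ⟩
    t * y + t * (q^ M * d)                      ≈⟨ +-congˡ (*-congʳ t≈) ⟩
    t * y + (0# + q^ K * s) * (q^ M * d)       ≈⟨ solve 5 (λ y k m s d → y :+ (con (ℤ.+ 0) :+ k :* s) :* (m :* d) := y :+ k :* m :* (s :* d)) refl (t * y) (q^ K) (q^ M) s d ⟩
    t * y + q^ K * q^ M * (s * d)              ≈⟨ +-congˡ (*-congʳ (q^-+ K M)) ⟨
    t * y + q^ (K ℕ.+ M) * (s * d)              ∎))
    where open import Relation.Binary.Reasoning.Setoid setoid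

  anti-mod : ∀ {f g M} N → (∀ j l → j ℕ.+ l ≡ N → f j l ≈ g j l [mod M ]) → anti f N ≈ anti g N [mod M ]
  anti-mod zero    h = h 0 0 ≡.refl
  anti-mod (suc N) h = mod-+ (h 0 (suc N) ≡.refl) (anti-mod N (λ j l e → h (suc j) l (≡.cong suc e)))

-- `half` is 1/(1 + q^0), the value at N₁ = 0 of the Pochhammer symbol with index -1.
record QRing c ℓ : Set (Level.suc (c Level.⊔ ℓ)) where
  field
    R : CommutativeRing c ℓ
    q : CommutativeRing.Carrier R
  open CommutativeRing R
  open PowerCongruence R q
  field
    inv      : ℕ → Carrier
    inv-law  : ∀ n → (1# - q^ (suc n)) * inv n ≈ 1#
    half     : Carrier
    half-law : half + half ≈ 1#

-- Reciprocal q-factorials and Bailey pairs in base q^(b+1).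

module InverseFactorial {c ℓ} (𝓡 : QRing c ℓ) (b : ℕ) where
  open QRing 𝓡
  open CommutativeRing R
  open PowerCongruence R q
  open Antidiagonal R
  open IntegerSolver R
  open import Relation.Binary.Reasoning.Setoid setoid

  abstract
    P : ℕ → Carrier
    P n = q^ (suc b ℕ.* n)

    P-def : ∀ n → P n ≈ q^ (suc b ℕ.* n)
    P-def n = refl

    -- `suc b * suc n` computes to `suc (n + b * suc n)`, so `inv-law` applies at this index without
    -- conversion.
    inv₁ : ℕ → Carrier
    inv₁ n = inv (n ℕ.+ b ℕ.* suc n)

    inv₁-law : ∀ n → (1# - P (suc n)) * inv₁ n ≈ 1#
    inv₁-law n = inv-law (n ℕ.+ b ℕ.* suc n)

    fac : ℕ → Carrier
    fac zero    = 1#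
    fac (suc n) = fac n * (1# - P (suc n))

    fac-0 : fac 0 ≈ 1#
    fac-0 = refl

    fac-suc : ∀ n → fac (suc n) ≈ fac n * (1# - P (suc n))
    fac-suc n = refl

    -- 1/(p;p)_n in base p = `P 1`, as `fac n` is (p;p)_n.
    iv : ℕ → Carrier
    iv zero    = 1#
    iv (suc n) = iv n * inv₁ n

    iv-0 : iv 0 ≈ 1#
    iv-0 = refl

    iv-suc : ∀ n → (1# - P (suc n)) * iv (suc n) ≈ iv n
    iv-suc n = begin
      (1# - P (suc n)) * (iv n * inv₁ n)    ≈⟨ solve 3 (λ a b c → a :* (b :* c) := b :* (a :* c)) refl _ _ _ ⟩
      iv n * ((1# - P (suc n)) * inv₁ n)    ≈⟨ *-congˡ (inv₁-law n) ⟩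
      iv n * 1#                             ≈⟨ *-identityʳ _ ⟩
      iv n                                  ∎

  P-cong : ∀ {m n} → m ≡ n → P m ≈ P n
  P-cong e = reflexive (≡.cong P e)

  P-+ : ∀ m n → P (m ℕ.+ n) ≈ P m * P n
  P-+ m n = begin
    P (m ℕ.+ n)                             ≈⟨ P-def (m ℕ.+ n) ⟩
    q^ (suc b ℕ.* (m ℕ.+ n))                ≈⟨ q^-cong (ℕ.*-distribˡ-+ (suc b) m n) ⟩
    q^ (suc b ℕ.* m ℕ.+ suc b ℕ.* n)        ≈⟨ q^-+ (suc b ℕ.* m) (suc b ℕ.* n) ⟩
    q^ (suc b ℕ.* m) * q^ (suc b ℕ.* n)     ≈⟨ *-cong (P-def m) (P-def n) ⟨
    P m * P n                               ∎

  P-0 : P 0 ≈ 1#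
  P-0 = trans (P-def 0) (trans (q^-cong (ℕ.*-zeroʳ (suc b))) q^-0)

  P-suc : ∀ n → P (suc n) ≈ P 1 * P n
  P-suc = P-+ 1

  P-mod : ∀ n → P n ≈ 0# [mod n ]
  P-mod n = q^ (b ℕ.* n) , trans (P-def n) (trans (q^-+ n (b ℕ.* n)) (sym (+-identityˡ _)))

  cancel : ∀ n {x y} → (1# - P (suc n)) * x ≈ (1# - P (suc n)) * y → x ≈ y
  cancel n {x} {y} e = begin
    x                                     ≈⟨ *-identityˡ x ⟨
    1# * x                                ≈⟨ *-congʳ (inv₁-law n) ⟨
    (1# - P (suc n)) * inv₁ n * x         ≈⟨ swap _ _ _ ⟩
    inv₁ n * ((1# - P (suc n)) * x)       ≈⟨ *-congˡ e ⟩
    inv₁ n * ((1# - P (suc n)) * y)       ≈⟨ swap _ _ _ ⟨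
    (1# - P (suc n)) * inv₁ n * y         ≈⟨ *-congʳ (inv₁-law n) ⟩
    1# * y                                ≈⟨ *-identityˡ y ⟩
    y                                     ∎
    where swap : ∀ a b c → a * b * c ≈ b * (a * c)
          swap = solve 3 (λ a b c → a :* b :* c := b :* (a :* c)) refl

  iv-cong : ∀ {m n} → m ≡ n → iv m ≈ iv n
  iv-cong e = reflexive (≡.cong iv e)

  fac-iv : ∀ n → fac n * iv n ≈ 1#
  fac-iv zero    = trans (*-cong fac-0 iv-0) (*-identityˡ 1#)
  fac-iv (suc n) = begin
    fac (suc n) * iv (suc n)                ≈⟨ trans (*-congʳ (fac-suc n)) (*-assoc _ _ _) ⟩
    fac n * ((1# - P (suc n)) * iv (suc n)) ≈⟨ *-congˡ (iv-suc n) ⟩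
    fac n * iv n                          ≈⟨ fac-iv n ⟩
    1#                                    ∎

  1-P0≈0 : 1# - P 0 ≈ 0#
  1-P0≈0 = trans (+-congˡ (-‿cong P-0)) (-‿inverseʳ 1#)

  vandermondeTerm : ℕ → ℕ → ℕ → Carrier
  vandermondeTerm s j l = P (j ℕ.* j ℕ.+ j ℕ.* s) * (iv l * iv j * iv (j ℕ.+ s))

  -- q-Chu–Vandermonde; the recurrence in M comes from
  -- 1 - P (j + l) = (1 - P l) + P l (1 - P j).
  vandermonde : ∀ M s → anti (vandermondeTerm s) M ≈ iv M * iv (M ℕ.+ s)
  vandermonde zero s = trans (*-cong P-0 (*-congʳ (*-congˡ iv-0)))
    (solve 2 (λ u v → :1 :* (u :* :1 :* v) := u :* v) refl (iv 0) (iv s))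
  vandermonde (suc M) s = cancel M (begin
    (1# - P (suc M)) * anti (vandermondeTerm s) (suc M)
      ≈⟨ anti-*ˡ _ (vandermondeTerm s) (suc M) ⟩
    anti (λ j l → (1# - P (suc M)) * vandermondeTerm s j l) (suc M)
      ≈⟨ anti-cong′ (suc M) split ⟩
    anti (λ j l → A j l + B j l) (suc M)
      ≈⟨ anti-+ A B (suc M) ⟩
    anti A (suc M) + anti B (suc M)
      ≈⟨ +-cong (anti-snoc A M) refl ⟩
    (anti (λ j l → A j (suc l)) M + A (suc M) 0) + (B 0 (suc M) + anti (λ j l → B (suc j) l) M)
      ≈⟨ +-cong (+-cong (anti-cong M A-suc) A-0) (+-cong B-0 (anti-cong′ M B-suc)) ⟩
    (anti (vandermondeTerm s) M + 0#) + (0# + anti (λ j l → P (suc (M ℕ.+ s)) * vandermondeTerm (suc s) j l) M)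
      ≈⟨ +-cong (+-identityʳ _) (trans (+-identityˡ _) (sym (anti-*ˡ _ _ M))) ⟩
    anti (vandermondeTerm s) M + P (suc (M ℕ.+ s)) * anti (vandermondeTerm (suc s)) M
      -- The induction uses both s and s + 1: removing one from j in the second part turns j(j + s)
      -- into an exponent of the shape j(j + (s + 1)), up to a constant.
      ≈⟨ +-cong (vandermonde M s) (*-congˡ (vandermonde M (suc s))) ⟩
    iv M * iv (M ℕ.+ s) + P (suc (M ℕ.+ s)) * (iv M * iv (M ℕ.+ suc s))
      ≈⟨ +-cong (*-congˡ (sym (iv-suc (M ℕ.+ s)))) (*-congˡ (*-congˡ (iv-cong (ℕ.+-suc M s)))) ⟩
    iv M * ((1# - P (suc (M ℕ.+ s))) * iv (suc (M ℕ.+ s))) + P (suc (M ℕ.+ s)) * (iv M * iv (suc (M ℕ.+ s)))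
      ≈⟨ solve 3 (λ a t v → a :* ((:1 :- t) :* v) :+ t :* (a :* v) := a :* v) refl _ _ _ ⟩
    iv M * iv (suc (M ℕ.+ s))
      ≈⟨ *-congʳ (iv-suc M) ⟨
    (1# - P (suc M)) * iv (suc M) * iv (suc M ℕ.+ s)
      ≈⟨ *-assoc _ _ _ ⟩
    (1# - P (suc M)) * (iv (suc M) * iv (suc M ℕ.+ s)) ∎)
    where
    A B : ℕ → ℕ → Carrier
    A j l = (1# - P l) * vandermondeTerm s j l
    B j l = P l * ((1# - P j) * vandermondeTerm s j l)
    split : ∀ j l → j ℕ.+ l ≡ suc M → (1# - P (suc M)) * vandermondeTerm s j l ≈ A j l + B j l
    split j l e = trans (*-congʳ (+-congˡ (-‿cong (trans (P-cong (≡.sym e)) (P-+ j l)))))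
      (solve 3 (λ x y t → (:1 :- x :* y) :* t := (:1 :- y) :* t :+ y :* ((:1 :- x) :* t)) refl (P j) (P l) _)
    A-0 : A (suc M) 0 ≈ 0#
    A-0 = trans (*-congʳ 1-P0≈0) (zeroˡ _)
    B-0 : B 0 (suc M) ≈ 0#
    B-0 = trans (*-congˡ (trans (*-congʳ 1-P0≈0) (zeroˡ _))) (zeroʳ _)
    A-suc : ∀ j l → A j (suc l) ≈ vandermondeTerm s j l
    A-suc j l = trans (solve 5 (λ x p a b v → x :* (p :* (a :* b :* v)) := p :* ((x :* a) :* b :* v)) refl _ _ _ _ _)
                      (*-congˡ (*-congʳ (*-congʳ (iv-suc l))))
    exponent : ∀ j l s → l ℕ.+ (suc j ℕ.* suc j ℕ.+ suc j ℕ.* s) ≡ suc (j ℕ.+ l ℕ.+ s) ℕ.+ (j ℕ.* j ℕ.+ j ℕ.* suc s)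
    exponent = solve-∀
    B-suc : ∀ j l → j ℕ.+ l ≡ M → B (suc j) l ≈ P (suc (M ℕ.+ s)) * vandermondeTerm (suc s) j l
    B-suc j l e = begin
      P l * ((1# - P (suc j)) * (P _ * (iv l * iv (suc j) * iv (suc j ℕ.+ s))))
        ≈⟨ solve 6 (λ y x p a b v → y :* (x :* (p :* (a :* b :* v))) := (y :* p) :* (a :* (x :* b) :* v)) refl _ _ _ _ _ _ ⟩
      P l * P (suc j ℕ.* suc j ℕ.+ suc j ℕ.* s) * (iv l * ((1# - P (suc j)) * iv (suc j)) * iv (suc j ℕ.+ s))
        ≈⟨ *-cong (trans (sym (P-+ _ _)) (trans (P-cong (≡.trans (exponent j l s) (≡.cong (λ t → suc (t ℕ.+ s) ℕ.+ (j ℕ.* j ℕ.+ j ℕ.* suc s)) e))) (P-+ _ _)))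
                  (*-cong (*-congˡ (iv-suc j)) (iv-cong (≡.sym (ℕ.+-suc j s)))) ⟩
      P (suc (M ℕ.+ s)) * P (j ℕ.* j ℕ.+ j ℕ.* suc s) * (iv l * iv j * iv (j ℕ.+ suc s))
        ≈⟨ *-assoc _ _ _ ⟩
      P (suc (M ℕ.+ s)) * vandermondeTerm (suc s) j l ∎

  -- The β of a Bailey pair relative to a = P σ, up to the factor 1 - P 1 when σ = 1.
  bailey : ℕ → (ℕ → Carrier) → ℕ → Carrier
  bailey σ α = anti (λ r l → α r * (iv l * iv (l ℕ.+ (r ℕ.+ r ℕ.+ σ))))

  -- The β-side of Bailey's lemma for a = p^σ with both parameters ρ₁, ρ₂ sent to infinity.
  baileyStep : ℕ → (ℕ → Carrier) → ℕ → Carrier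
  baileyStep σ β = anti (λ a c → P (a ℕ.* a ℕ.+ σ ℕ.* a) * iv c * β a)

  -- Since (r + l)² + σ(r + l) = (r² + σr) + l(l + 2r + σ), the sum over l at fixed r is
  -- q-Chu-Vandermonde with s = 2r + σ, and α r only gains the factor p^(r² + σr).
  baileyStep-bailey : ∀ σ {α β} → (∀ N → β N ≈ bailey σ α N) →
    ∀ N → baileyStep σ β N ≈ bailey σ (λ r → P (r ℕ.* r ℕ.+ σ ℕ.* r) * α r) N
  baileyStep-bailey σ {α} {β} h N = begin
    anti (λ a c → P (a ℕ.* a ℕ.+ σ ℕ.* a) * iv c * β a) N
      ≈⟨ anti-cong N (λ a c → trans (*-congˡ (h a)) (anti-*ˡ _ _ a)) ⟩
    anti (λ a c → anti (λ r l → P (a ℕ.* a ℕ.+ σ ℕ.* a) * iv c * (α r * (iv l * iv (l ℕ.+ (r ℕ.+ r ℕ.+ σ))))) a) N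
      ≈⟨ anti-cong N (λ a c → anti-cong′ a (λ r l e → term r l c a e)) ⟩
    anti (λ a c → anti (λ r l → P (r ℕ.* r ℕ.+ σ ℕ.* r) * α r * vandermondeTerm (r ℕ.+ r ℕ.+ σ) l c) a) N
      ≈⟨ anti-assoc (λ r l c → P (r ℕ.* r ℕ.+ σ ℕ.* r) * α r * vandermondeTerm (r ℕ.+ r ℕ.+ σ) l c) N ⟩
    anti (λ r M → anti (λ l c → P (r ℕ.* r ℕ.+ σ ℕ.* r) * α r * vandermondeTerm (r ℕ.+ r ℕ.+ σ) l c) M) N
      ≈⟨ anti-cong N (λ r M → trans (sym (anti-*ˡ _ _ M)) (*-congˡ (vandermonde M (r ℕ.+ r ℕ.+ σ)))) ⟩
    bailey σ (λ r → P (r ℕ.* r ℕ.+ σ ℕ.* r) * α r) N ∎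
    where
    exponent : ∀ r l σ → (r ℕ.+ l) ℕ.* (r ℕ.+ l) ℕ.+ σ ℕ.* (r ℕ.+ l) ≡ (r ℕ.* r ℕ.+ σ ℕ.* r) ℕ.+ (l ℕ.* l ℕ.+ l ℕ.* (r ℕ.+ r ℕ.+ σ))
    exponent = solve-∀
    term : ∀ r l c a → r ℕ.+ l ≡ a →
      P (a ℕ.* a ℕ.+ σ ℕ.* a) * iv c * (α r * (iv l * iv (l ℕ.+ (r ℕ.+ r ℕ.+ σ))))
        ≈ P (r ℕ.* r ℕ.+ σ ℕ.* r) * α r * vandermondeTerm (r ℕ.+ r ℕ.+ σ) l c
    term r l c .(r ℕ.+ l) ≡.refl = trans (*-congʳ (*-congʳ (trans (P-cong (exponent r l σ)) (P-+ _ _))))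
      (solve 6 (λ x y c a l v → x :* y :* c :* (a :* (l :* v)) := x :* a :* (y :* (c :* l :* v))) refl _ _ _ _ _ _)

  -- The α relative to a = 1 after β is multiplied by 1 + ε p^N; the first clause is the second one
  -- with c(-1) read as 0. The change of a takes ε = 1, the unit pair takes ε = -1.
  transfer : Carrier → (ℕ → Carrier) → ℕ → Carrier
  transfer ε c zero    = (1# + ε) * c 0
  transfer ε c (suc r) = (1# + ε * P (suc r)) * (c (suc r) - ε * P r * c r)

  -- Since ε² = 1,  (1 + ε P (r + l)) (1 - P (2r + 1))
  --   = (1 + ε P r) (1 - P (l + 2r + 1)) - ε P r (1 + ε P (r + 1)) (1 - P l).
  bailey-transfer : ∀ ε c → ε * ε ≈ 1# → ∀ N →
    (1# + ε * P N) * bailey 1 (λ r → c r * (1# - P (r ℕ.+ r ℕ.+ 1))) N ≈ bailey 0 (transfer ε c) N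
  bailey-transfer ε c ε² N = begin
    (1# + ε * P N) * bailey 1 (λ r → c r * (1# - P (r ℕ.+ r ℕ.+ 1))) N
      ≈⟨ anti-*ˡ _ _ N ⟩
    anti (λ r l → (1# + ε * P N) * (c r * (1# - P (r ℕ.+ r ℕ.+ 1)) * (iv l * iv (l ℕ.+ (r ℕ.+ r ℕ.+ 1))))) N
      ≈⟨ anti-cong′ N split ⟩
    anti (λ r l → F r l + H r l) N
      ≈⟨ collect N ⟩
    bailey 0 (transfer ε c) N ∎
    where
    F H : ℕ → ℕ → Carrier
    F r l = (1# + ε * P r) * c r * (iv l * iv (l ℕ.+ (r ℕ.+ r ℕ.+ 0)))
    H r l = - ((1# + ε * P (suc r)) * (ε * P r * c r)) * ((1# - P l) * iv l * iv (l ℕ.+ (r ℕ.+ r ℕ.+ 1)))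

    index : ∀ l r → suc (l ℕ.+ (r ℕ.+ r ℕ.+ 0)) ≡ l ℕ.+ (r ℕ.+ r ℕ.+ 1)
    index = solve-∀
    index′ : ∀ l r → suc l ℕ.+ (r ℕ.+ r ℕ.+ 1) ≡ l ℕ.+ (suc r ℕ.+ suc r ℕ.+ 0)
    index′ = solve-∀

    split : ∀ r l → r ℕ.+ l ≡ N →
      (1# + ε * P N) * (c r * (1# - P (r ℕ.+ r ℕ.+ 1)) * (iv l * iv (l ℕ.+ (r ℕ.+ r ℕ.+ 1)))) ≈ F r l + H r l
    split r l e = begin
      (1# + ε * P N) * (c r * (1# - P (r ℕ.+ r ℕ.+ 1)) * (iv l * v))
        ≈⟨ *-cong (+-congˡ (*-congˡ (trans (P-cong (≡.sym e)) (P-+ r l)))) (*-congʳ (*-congˡ (+-congˡ (-‿cong Pr)))) ⟩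
      (1# + ε * (P r * P l)) * (c r * (1# - P r * P r * P 1) * (iv l * v))
        ≈⟨ solve 7 (λ ε x y z c i v → (:1 :+ ε :* (x :* y)) :* (c :* (:1 :- x :* x :* z) :* (i :* v))
             := (:1 :+ ε :* x) :* c :* (i :* ((:1 :- y :* (x :* x :* z)) :* v))
                :+ (:- ((:1 :+ ε :* (z :* x)) :* (ε :* x :* c))) :* ((:1 :- y) :* i :* v)
                :+ (ε :* ε :- :1) :* (c :* z :* x :* x :* (:1 :- y) :* i :* v))
             refl ε (P r) (P l) (P 1) (c r) (iv l) v ⟩
      (1# + ε * P r) * c r * (iv l * ((1# - P l * (P r * P r * P 1)) * v))
        + (- ((1# + ε * (P 1 * P r)) * (ε * P r * c r))) * ((1# - P l) * iv l * v)
        + (ε * ε - 1#) * (c r * P 1 * P r * P r * (1# - P l) * iv l * v)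
        ≈⟨ +-cong (+-cong (*-congˡ (*-congˡ lower)) (*-congʳ (-‿cong (*-congʳ (+-congˡ (*-congˡ (sym (P-suc r))))))))
                  (trans (*-congʳ (trans (+-congʳ ε²) (-‿inverseʳ 1#))) (zeroˡ _)) ⟩
      F r l + H r l + 0#
        ≈⟨ +-identityʳ _ ⟩
      F r l + H r l ∎
      where
      v = iv (l ℕ.+ (r ℕ.+ r ℕ.+ 1))
      Pr : P (r ℕ.+ r ℕ.+ 1) ≈ P r * P r * P 1
      Pr = trans (P-+ (r ℕ.+ r) 1) (*-congʳ (P-+ r r))
      lower : (1# - P l * (P r * P r * P 1)) * v ≈ iv (l ℕ.+ (r ℕ.+ r ℕ.+ 0))
      lower = trans (*-cong (+-congˡ (-‿cong (trans (*-congˡ (sym Pr)) (trans (sym (P-+ l _)) (P-cong (≡.sym (index l r)))))))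
                            (iv-cong (≡.sym (index l r))))
                    (iv-suc _)

    H-0 : ∀ r → H r 0 ≈ 0#
    H-0 r = trans (*-congˡ (trans (*-congʳ (trans (*-congʳ 1-P0≈0) (zeroˡ _))) (zeroˡ _))) (zeroʳ _)

    F-0 : ∀ l → F 0 l ≈ (1# + ε) * c 0 * (iv l * iv (l ℕ.+ 0))
    F-0 l = *-congʳ (*-congʳ (+-congˡ (trans (*-congˡ P-0) (*-identityʳ ε))))

    FH-suc : ∀ r l → F (suc r) l + H r (suc l) ≈ transfer ε c (suc r) * (iv l * iv (l ℕ.+ (suc r ℕ.+ suc r ℕ.+ 0)))
    FH-suc r l = trans (+-congˡ (*-congˡ (*-cong (iv-suc l) (iv-cong (index′ l r)))))
      (solve 4 (λ u c d t → u :* c :* t :+ (:- (u :* d)) :* t := u :* (c :- d) :* t) refl _ _ _ _)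

    collect : ∀ N → anti (λ r l → F r l + H r l) N ≈ bailey 0 (transfer ε c) N
    collect zero = trans (+-congˡ (H-0 0)) (trans (+-identityʳ _) (F-0 0))
    collect (suc N) = begin
      anti (λ r l → F r l + H r l) (suc N)
        ≈⟨ anti-+ F H (suc N) ⟩
      anti F (suc N) + anti H (suc N)
        -- `H` vanishes at l = 0, so its l can be shifted by one; `H r (suc l)` then carries the
        -- same reciprocals as `F (suc r) l`.
        ≈⟨ +-congˡ (trans (anti-snoc H N) (trans (+-congˡ (H-0 (suc N))) (+-identityʳ _))) ⟩
      (F 0 (suc N) + anti (λ r l → F (suc r) l) N) + anti (λ r l → H r (suc l)) N
        ≈⟨ trans (+-assoc _ _ _) (+-cong (F-0 (suc N)) (sym (anti-+ _ _ N))) ⟩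
      (1# + ε) * c 0 * (iv (suc N) * iv (suc N ℕ.+ 0)) + anti (λ r l → F (suc r) l + H r (suc l)) N
        ≈⟨ +-congˡ (anti-cong N FH-suc) ⟩
      bailey 0 (transfer ε c) (suc N) ∎

-- The Bailey chain in base p = q² and the q-Gauss sum that ends it.

module BaileyChain {c ℓ} (𝓡 : QRing c ℓ) where
  open QRing 𝓡
  open CommutativeRing R
  open PowerCongruence R q
  open Antidiagonal R
  open IntegerSolver R
  open InverseFactorial 𝓡 1
  open import Relation.Binary.Reasoning.Setoid setoid

  P-1 : P 1 ≈ q * q
  P-1 = trans (P-def 1) (trans (q^-suc 1) (*-congˡ q^-1))

  δ : ℕ → Carrier
  δ zero    = 1#
  δ (suc _) = 0#

  -- c-coeff m r = (-1)^r p^(r(r-1)/2 + m r(r+1)), where p = q².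
  c-coeff : ℕ → ℕ → Carrier
  c-coeff m zero    = 1#
  c-coeff m (suc r) = - (P (r ℕ.+ (m ℕ.+ m) ℕ.* suc r) * c-coeff m r)

  -- A step relative to a = p multiplies α r by p^(r² + r), which is what raising m by one does to
  -- the exponent.
  c-coeff-suc : ∀ m r → P (r ℕ.* r ℕ.+ 1 ℕ.* r) * c-coeff m r ≈ c-coeff (suc m) r
  c-coeff-suc m zero = trans (*-congʳ P-0) (*-identityˡ _)
  c-coeff-suc m (suc r) = begin
    P (suc r ℕ.* suc r ℕ.+ 1 ℕ.* suc r) * (- (P (r ℕ.+ (m ℕ.+ m) ℕ.* suc r) * c-coeff m r))
      ≈⟨ solve 3 (λ a b c → a :* (:- (b :* c)) := :- ((a :* b) :* c)) refl _ _ _ ⟩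
    - (P (suc r ℕ.* suc r ℕ.+ 1 ℕ.* suc r) * P (r ℕ.+ (m ℕ.+ m) ℕ.* suc r) * c-coeff m r)
      ≈⟨ -‿cong (*-congʳ (trans (sym (P-+ _ _)) (trans (P-cong (exponent m r)) (P-+ _ _)))) ⟩
    - (P (r ℕ.+ (suc m ℕ.+ suc m) ℕ.* suc r) * P (r ℕ.* r ℕ.+ 1 ℕ.* r) * c-coeff m r)
      ≈⟨ -‿cong (trans (*-assoc _ _ _) (*-congˡ (c-coeff-suc m r))) ⟩
    - (P (r ℕ.+ (suc m ℕ.+ suc m) ℕ.* suc r) * c-coeff (suc m) r) ∎
    where
    exponent : ∀ m r → (suc r ℕ.* suc r ℕ.+ 1 ℕ.* suc r) ℕ.+ (r ℕ.+ (m ℕ.+ m) ℕ.* suc r)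
                     ≡ (r ℕ.+ (suc m ℕ.+ suc m) ℕ.* suc r) ℕ.+ (r ℕ.* r ℕ.+ 1 ℕ.* r)
    exponent = solve-∀

  bailey-cong : ∀ σ {α α′} → (∀ r → α r ≈ α′ r) → ∀ N → bailey σ α N ≈ bailey σ α′ N
  bailey-cong σ h N = anti-cong N (λ r l → *-congʳ (h r))

  bailey-zero : ∀ σ {α} → (∀ r → α r ≈ 0#) → ∀ N → bailey σ α N ≈ 0#
  bailey-zero σ h N = trans (anti-cong N (λ r l → trans (*-congʳ (h r)) (zeroˡ _))) (anti-zero N)

  -- Taking ε = -1 in bailey-transfer shows that (1 - P N) annihilates the right-hand side.
  unit-bailey : ∀ N → δ N ≈ bailey 1 (λ r → c-coeff 0 r * (1# - P (r ℕ.+ r ℕ.+ 1))) N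
  unit-bailey zero = sym (begin
    1# * (1# - P 1) * (iv 0 * iv 1)       ≈⟨ solve 3 (λ a b c → :1 :* a :* (b :* c) := b :* (a :* c)) refl _ _ _ ⟩
    iv 0 * ((1# - P 1) * iv 1)            ≈⟨ *-cong iv-0 (trans (iv-suc 0) iv-0) ⟩
    1# * 1#                               ≈⟨ *-identityˡ 1# ⟩
    1#                                    ∎)
  unit-bailey (suc N) = cancel N (begin
    (1# - P (suc N)) * 0#                 ≈⟨ zeroʳ _ ⟩
    0#                                    ≈⟨ bailey-zero 0 vanish (suc N) ⟨
    bailey 0 (transfer (- 1#) (c-coeff 0)) (suc N)
      ≈⟨ bailey-transfer (- 1#) (c-coeff 0) (solve 0 ((:- :1) :* (:- :1) := :1) refl) (suc N) ⟨
    (1# + - 1# * P (suc N)) * S           ≈⟨ solve 2 (λ x s → (:1 :+ (:- :1) :* x) :* s := (:1 :- x) :* s) refl _ S ⟩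
    (1# - P (suc N)) * S                  ∎)
    where
    S = bailey 1 (λ r → c-coeff 0 r * (1# - P (r ℕ.+ r ℕ.+ 1))) (suc N)
    vanish : ∀ r → transfer (- 1#) (c-coeff 0) r ≈ 0#
    -- At r = 0 the factor 1 + ε is zero; for larger r the difference vanishes because
    -- `c-coeff 0 (suc r)` is -p^r times `c-coeff 0 r`.
    vanish zero    = trans (*-congʳ (-‿inverseʳ 1#)) (zeroˡ _)
    vanish (suc r) = trans (*-congˡ (begin
      - (P (r ℕ.+ 0) * c-coeff 0 r) - - 1# * P r * c-coeff 0 r
        ≈⟨ +-congʳ (-‿cong (*-congʳ (P-cong (ℕ.+-identityʳ r)))) ⟩
      - (P r * c-coeff 0 r) - - 1# * P r * c-coeff 0 r
        ≈⟨ solve 2 (λ p c → :- (p :* c) :- (:- :1) :* p :* c := con (ℤ.+ 0)) refl _ _ ⟩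
      0# ∎)) (zeroʳ _)

  -- For N = N_i and m = k - i this sums over N_{i+1}, ..., N_k, where `δ` forces N_k = 0.
  innerSum : ℕ → ℕ → Carrier
  innerSum zero    = δ
  innerSum (suc m) = baileyStep 1 (innerSum m)

  innerSum-bailey : ∀ m N → innerSum m N ≈ bailey 1 (λ r → c-coeff m r * (1# - P (r ℕ.+ r ℕ.+ 1))) N
  innerSum-bailey zero    = unit-bailey
  innerSum-bailey (suc m) N = trans (baileyStep-bailey 1 (innerSum-bailey m) N)
    (bailey-cong 1 (λ r → trans (sym (*-assoc _ _ _)) (*-congʳ (c-coeff-suc m r))) N)

  outerSum : ℕ → ℕ → ℕ → Carrier
  outerSum m zero    N = (1# + P N) * innerSum m N
  outerSum m (suc j)   = baileyStep 0 (outerSum m j)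

  -- The transferred α without its factor 1 + p^r. That factor is kept apart because `gaussSum r`
  -- has a simple recurrence only when multiplied by it.
  a-coeff : ℕ → ℕ → Carrier
  a-coeff m zero    = 1#
  a-coeff m (suc r) = c-coeff m (suc r) - P r * c-coeff m r

  -- A step relative to a = 1 multiplies α r by p^(r²), so j of them contribute p^(j r²).
  outerSum-bailey : ∀ m j N → outerSum m j N ≈ bailey 0 (λ r → (1# + P r) * (P (j ℕ.* (r ℕ.* r)) * a-coeff m r)) N
  outerSum-bailey m zero N = begin
    (1# + P N) * innerSum m N
      ≈⟨ *-cong (+-congˡ (sym (*-identityˡ _))) (innerSum-bailey m N) ⟩
    (1# + 1# * P N) * bailey 1 (λ r → c-coeff m r * (1# - P (r ℕ.+ r ℕ.+ 1))) N
      ≈⟨ bailey-transfer 1# (c-coeff m) (*-identityˡ 1#) N ⟩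
    bailey 0 (transfer 1# (c-coeff m)) N
      ≈⟨ bailey-cong 0 simplify N ⟩
    bailey 0 (λ r → (1# + P r) * (P 0 * a-coeff m r)) N ∎
    where
    simplify : ∀ r → transfer 1# (c-coeff m) r ≈ (1# + P r) * (P 0 * a-coeff m r)
    simplify zero    = *-cong (+-congˡ (sym P-0)) (trans (sym (*-identityˡ _)) (*-congʳ (sym P-0)))
    simplify (suc r) = *-cong (+-congˡ (*-identityˡ _))
      (trans (+-congˡ (-‿cong (*-congʳ (*-identityˡ _)))) (trans (sym (*-identityˡ _)) (*-congʳ (sym P-0))))
  outerSum-bailey m (suc j) N = trans (baileyStep-bailey 0 (outerSum-bailey m j) N)
    (bailey-cong 0 (λ r → begin
      P (r ℕ.* r ℕ.+ 0 ℕ.* r) * ((1# + P r) * (P (j ℕ.* (r ℕ.* r)) * a-coeff m r))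
        ≈⟨ solve 4 (λ a b c d → a :* (b :* (c :* d)) := b :* ((a :* c) :* d)) refl _ _ _ _ ⟩
      (1# + P r) * (P (r ℕ.* r ℕ.+ 0 ℕ.* r) * P (j ℕ.* (r ℕ.* r)) * a-coeff m r)
        ≈⟨ *-congˡ (*-congʳ (trans (sym (P-+ _ _)) (P-cong (≡.cong (ℕ._+ j ℕ.* (r ℕ.* r)) (ℕ.+-identityʳ (r ℕ.* r)))))) ⟩
      (1# + P r) * (P (suc j ℕ.* (r ℕ.* r)) * a-coeff m r) ∎) N)

  -- w N = (-1;q)_{2N} q^N / 2
  w : ℕ → Carrier
  w zero    = half
  w (suc N) = q * (1# + P N) * (1# + q * P N) * w N

  w-cong : ∀ {m n} → m ≡ n → w m ≈ w n
  w-cong e = reflexive (≡.cong w e)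

  -- The source of every remainder estimate for the multisum: the reciprocal factorials next to `w`
  -- are not small.
  w-mod : ∀ N → w N ≈ 0# [mod N ]
  w-mod zero = half , sym (trans (+-identityˡ _) (trans (*-congʳ q^-0) (*-identityˡ _)))
  w-mod (suc N) with w-mod N
  ... | d , e = (1# + P N) * (1# + q * P N) * d , (begin
    q * (1# + P N) * (1# + q * P N) * w N                     ≈⟨ *-congˡ (trans e (+-identityˡ _)) ⟩
    q * (1# + P N) * (1# + q * P N) * (q^ N * d)              ≈⟨ solve 5 (λ q a b x d → q :* a :* b :* (x :* d) := q :* x :* (a :* b :* d)) refl _ _ _ _ _ ⟩
    q * q^ N * ((1# + P N) * (1# + q * P N) * d)              ≈⟨ trans (*-congʳ (sym (q^-suc N))) (sym (+-identityˡ _)) ⟩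
    0# + q^ (suc N) * ((1# + P N) * (1# + q * P N) * d)       ∎)

  gaussTerm : ℕ → ℕ → Carrier
  gaussTerm r l = w (r ℕ.+ l) * (iv l * iv (l ℕ.+ (r ℕ.+ r ℕ.+ 0)))

  gaussSum : ℕ → ℕ → Carrier
  gaussSum r = sumTo (gaussTerm r)

  -- The boundary term left when the recurrence in r is cut off at M. Its factor `w (suc (r + M))`
  -- makes it divisible by q^(r+M+1).
  gaussError : ℕ → ℕ → Carrier
  gaussError r M = (1# - q * P r) * (w (suc (r ℕ.+ M)) * (iv M * iv (M ℕ.+ (r ℕ.+ r ℕ.+ 1))))

  shiftIndex : ∀ l r → suc (l ℕ.+ (r ℕ.+ r ℕ.+ 0)) ≡ l ℕ.+ (r ℕ.+ r ℕ.+ 1)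
  shiftIndex = solve-∀

  iv-lower : ∀ l r → iv (l ℕ.+ (r ℕ.+ r ℕ.+ 0)) ≈ (1# - P (suc (l ℕ.+ (r ℕ.+ r ℕ.+ 0)))) * iv (l ℕ.+ (r ℕ.+ r ℕ.+ 1))
  iv-lower l r = trans (sym (iv-suc _)) (*-congˡ (iv-cong (shiftIndex l r)))

  -- Because p = q², 1 - p^(2r+1) = (1 - q p^r)(1 + q p^r); the second factor completes `w r` to
  -- `w (suc r)`.
  gaussError-0 : ∀ r → q * (1# + P r) * gaussTerm r 0 ≈ gaussError r 0
  gaussError-0 r = begin
    q * (1# + P r) * (w (r ℕ.+ 0) * (iv 0 * iv (r ℕ.+ r ℕ.+ 0)))
      ≈⟨ *-congˡ (*-cong (w-cong (ℕ.+-identityʳ r)) (*-congˡ (trans (iv-lower 0 r) (*-congʳ (+-congˡ (-‿cong Psuc)))))) ⟩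
    q * (1# + P r) * (w r * (iv 0 * ((1# - q * q * (P r * P r)) * iv (r ℕ.+ r ℕ.+ 1))))
      ≈⟨ solve 5 (λ q a w i v → q :* (:1 :+ a) :* (w :* (i :* ((:1 :- q :* q :* (a :* a)) :* v)))
            := (:1 :- q :* a) :* (q :* (:1 :+ a) :* (:1 :+ q :* a) :* w :* (i :* v))) refl q (P r) (w r) (iv 0) _ ⟩
    (1# - q * P r) * (w (suc r) * (iv 0 * iv (r ℕ.+ r ℕ.+ 1)))
      ≈⟨ *-congˡ (*-congʳ (w-cong (≡.cong suc (≡.sym (ℕ.+-identityʳ r))))) ⟩
    gaussError r 0 ∎
    where
    Psuc : P (suc (r ℕ.+ r ℕ.+ 0)) ≈ q * q * (P r * P r)
    Psuc = trans (P-suc _) (*-cong P-1 (trans (P-cong (ℕ.+-identityʳ (r ℕ.+ r))) (P-+ r r)))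

  -- Once everything is written over `w (r + suc M)`, `iv (suc M)` and `iv (suc M + (2r + 1))`, this
  -- is a polynomial identity in q, p^r and p^(M+1).
  gaussError-suc : ∀ r M →
    q * (1# + P r) * gaussTerm r (suc M) + gaussError r M ≈ (1# + P (suc r)) * gaussTerm (suc r) M + gaussError r (suc M)
  gaussError-suc r M = begin
    q * (1# + P r) * (W * (i₁ * iv (suc M ℕ.+ (r ℕ.+ r ℕ.+ 0))))
      + (1# - q * P r) * (w (suc (r ℕ.+ M)) * (iv M * iv (M ℕ.+ (r ℕ.+ r ℕ.+ 1))))
      ≈⟨ +-cong (*-congˡ (*-congˡ (*-congˡ upper)))
                (*-congˡ (*-cong (w-cong (≡.sym (ℕ.+-suc r M))) (*-cong iM upper′))) ⟩
    q * (1# + P r) * (W * (i₁ * ((1# - y * (P r * P r) * (q * q)) * i₂)))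
      + (1# - q * P r) * (W * ((1# - y) * i₁ * ((1# - y * (P r * P r) * (q * q)) * i₂)))
      ≈⟨ solve 6 (λ q a y W i v →
           q :* (:1 :+ a) :* (W :* (i :* ((:1 :- y :* (a :* a) :* (q :* q)) :* v)))
             :+ (:1 :- q :* a) :* (W :* ((:1 :- y) :* i :* ((:1 :- y :* (a :* a) :* (q :* q)) :* v)))
           := (:1 :+ q :* q :* a) :* (W :* ((:1 :- y) :* i :* v))
             :+ (:1 :- q :* a) :* (q :* (:1 :+ a :* y) :* (:1 :+ q :* (a :* y)) :* W :* (i :* v)))
           refl q (P r) y W i₁ i₂ ⟩
    (1# + q * q * P r) * (W * ((1# - y) * i₁ * i₂))
      + (1# - q * P r) * (q * (1# + P r * y) * (1# + q * (P r * y)) * W * (i₁ * i₂))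
      ≈⟨ +-cong (*-cong (+-congˡ (trans (*-congʳ (sym P-1)) (sym (P-suc r))))
                        (*-cong (w-cong (ℕ.+-suc r M)) (*-cong (iv-suc M) (iv-cong (index₂ M r)))))
                (*-congˡ (*-congʳ (*-congʳ (*-cong (*-congˡ (+-congˡ (sym (P-+ r (suc M))))) (+-congˡ (*-congˡ (sym (P-+ r (suc M))))))))) ⟩
    (1# + P (suc r)) * gaussTerm (suc r) M + gaussError r (suc M) ∎
    where
    y = P (suc M)
    W = w (r ℕ.+ suc M)
    i₁ = iv (suc M)
    i₂ = iv (suc M ℕ.+ (r ℕ.+ r ℕ.+ 1))
    index₂ : ∀ M r → suc M ℕ.+ (r ℕ.+ r ℕ.+ 1) ≡ M ℕ.+ (suc r ℕ.+ suc r ℕ.+ 0)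
    index₂ = solve-∀
    index₃ : ∀ M r → suc (M ℕ.+ (r ℕ.+ r ℕ.+ 1)) ≡ suc M ℕ.+ (r ℕ.+ r) ℕ.+ 1
    index₃ = solve-∀
    P-split : P (suc M ℕ.+ (r ℕ.+ r) ℕ.+ 1) ≈ y * (P r * P r) * (q * q)
    P-split = trans (P-+ (suc M ℕ.+ (r ℕ.+ r)) 1) (*-cong (trans (P-+ (suc M) (r ℕ.+ r)) (*-congˡ (P-+ r r))) P-1)
    iM : iv M ≈ (1# - y) * i₁
    iM = sym (iv-suc M)
    upper′ : iv (M ℕ.+ (r ℕ.+ r ℕ.+ 1)) ≈ (1# - y * (P r * P r) * (q * q)) * i₂
    upper′ = trans (sym (iv-suc _)) (*-congʳ (+-congˡ (-‿cong (trans (P-cong (index₃ M r)) P-split))))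
    upper : iv (suc M ℕ.+ (r ℕ.+ r ℕ.+ 0)) ≈ (1# - y * (P r * P r) * (q * q)) * i₂
    upper = trans (iv-cong (shiftIndex M r)) upper′

  -- The telescoping form of the q-Gauss sum with ρ₁ = -1, ρ₂ = -q.
  gaussSum-suc : ∀ r M → q * (1# + P r) * gaussSum r (suc M) ≈ (1# + P (suc r)) * gaussSum (suc r) M + gaussError r (suc M)
  gaussSum-suc r zero = begin
    q * (1# + P r) * (gaussTerm r 0 + gaussTerm r 1)                     ≈⟨ distribˡ _ _ _ ⟩
    q * (1# + P r) * gaussTerm r 0 + q * (1# + P r) * gaussTerm r 1      ≈⟨ +-congʳ (gaussError-0 r) ⟩
    gaussError r 0 + q * (1# + P r) * gaussTerm r 1                      ≈⟨ +-comm _ _ ⟩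
    q * (1# + P r) * gaussTerm r 1 + gaussError r 0                      ≈⟨ gaussError-suc r 0 ⟩
    (1# + P (suc r)) * gaussTerm (suc r) 0 + gaussError r 1              ∎
  gaussSum-suc r (suc M) = begin
    q * (1# + P r) * gaussSum r (suc (suc M))
      ≈⟨ trans (*-congˡ (sumTo-snoc (gaussTerm r) (suc M))) (distribˡ _ _ _) ⟩
    q * (1# + P r) * gaussSum r (suc M) + q * (1# + P r) * gaussTerm r (suc (suc M))
      ≈⟨ +-congʳ (gaussSum-suc r M) ⟩
    ((1# + P (suc r)) * gaussSum (suc r) M + gaussError r (suc M)) + q * (1# + P r) * gaussTerm r (suc (suc M))
      ≈⟨ trans (+-assoc _ _ _) (+-congˡ (trans (+-comm _ _) (gaussError-suc r (suc M)))) ⟩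
    (1# + P (suc r)) * gaussSum (suc r) M + ((1# + P (suc r)) * gaussTerm (suc r) (suc M) + gaussError r (suc (suc M)))
      ≈⟨ trans (sym (+-assoc _ _ _)) (+-congʳ (trans (sym (distribˡ _ _ _)) (*-congˡ (sym (sumTo-snoc (gaussTerm (suc r)) M))))) ⟩
    (1# + P (suc r)) * gaussSum (suc r) (suc M) + gaussError r (suc (suc M)) ∎

  -- Lowering r by one gains a factor q and raises the upper limit by one. Hence r + l is invariant,
  -- all the errors share one modulus, and the dependence on r shrinks to q^r.
  gaussSum-mod : ∀ r l → (1# + P r) * gaussSum r l ≈ q^ r * ((1# + 1#) * gaussSum 0 (r ℕ.+ l)) [mod suc (r ℕ.+ l) ]
  gaussSum-mod zero l = mod-of-≈ (trans (*-congʳ (+-congˡ P-0)) (trans (sym (*-identityˡ _)) (*-congʳ (sym q^-0))))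
  gaussSum-mod (suc r) l =
    ≡.subst (λ t → (1# + P (suc r)) * gaussSum (suc r) l ≈ q^ (suc r) * ((1# + 1#) * gaussSum 0 t) [mod suc t ])
            (ℕ.+-suc r l) (mod-trans drop-error (mod-trans (mod-*ˡ q (gaussSum-mod r (suc l))) (mod-of-≈ regroup)))
    where
    error-mod : gaussError r (suc l) ≈ 0# [mod suc (r ℕ.+ suc l) ]
    error-mod = mod-trans (mod-*ˡ _ (mod-* (w-mod (suc (r ℕ.+ suc l))) mod-refl)) (mod-of-≈ (trans (*-congˡ (zeroˡ _)) (zeroʳ _)))
    drop-error : (1# + P (suc r)) * gaussSum (suc r) l ≈ q * ((1# + P r) * gaussSum r (suc l)) [mod suc (r ℕ.+ suc l) ]
    drop-error = mod-sym (mod-trans (mod-of-≈ (trans (sym (*-assoc _ _ _)) (gaussSum-suc r l)))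
                                    (mod-trans (mod-+ mod-refl error-mod) (mod-of-≈ (+-identityʳ _))))
    regroup : q * (q^ r * ((1# + 1#) * gaussSum 0 (r ℕ.+ suc l))) ≈ q^ (suc r) * ((1# + 1#) * gaussSum 0 (r ℕ.+ suc l))
    regroup = trans (sym (*-assoc _ _ _)) (*-congʳ (sym (q^-suc r)))

  multiSum : ℕ → ℕ → ℕ → Carrier
  multiSum m j = sumTo (λ N → w N * outerSum m j N)

  -- For r ≥ 1 the two parts of `a-coeff` are the terms n = r and n = -r of the series with terms
  -- (-1)^n q^((2j+2m+1)n² + 2mn); here m = k - i and j = i - 1.
  thetaTerm : ℕ → ℕ → ℕ → Carrier
  thetaTerm m j r = P (j ℕ.* (r ℕ.* r)) * a-coeff m r * q^ r

  theta : ℕ → ℕ → ℕ → Carrier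
  theta m j = sumTo (thetaTerm m j)

  -- After the Bailey pair is inserted and N₁ is summed first, the coefficient of α r is (1 + p^r)
  -- `gaussSum r b` with r + b = M, and `gaussSum-mod` leaves a constant depending on M alone.
  multiSum-theta : ∀ m j M → multiSum m j M ≈ theta m j M * ((1# + 1#) * gaussSum 0 M) [mod suc M ]
  multiSum-theta m j M = mod-trans (mod-of-≈ rearrange)
    (mod-trans (anti-mod M (λ { r l ≡.refl → mod-trans (mod-*ˡ (α r) (gaussSum-mod r l)) (mod-of-≈ (sym (*-assoc _ _ _))) }))
               (mod-of-≈ (sym (anti-*ʳ _ _ M))))
    where
    α : ℕ → Carrier
    α r = P (j ℕ.* (r ℕ.* r)) * a-coeff m r
    rearrange : multiSum m j M ≈ anti (λ r b → α r * ((1# + P r) * gaussSum r b)) M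
    rearrange = begin
      anti (λ N _ → w N * outerSum m j N) M
        ≈⟨ anti-cong M (λ N _ → trans (*-congˡ (outerSum-bailey m j N)) (anti-*ˡ _ _ N)) ⟩
      anti (λ N _ → anti (λ r l → w N * ((1# + P r) * α r * (iv l * iv (l ℕ.+ (r ℕ.+ r ℕ.+ 0))))) N) M
        ≈⟨ anti-cong M (λ N _ → anti-cong′ N (λ { r l ≡.refl →
             solve 4 (λ w p a i → w :* (p :* a :* i) := a :* p :* (w :* i)) refl _ _ _ _ })) ⟩
      anti (λ N _ → anti (λ r l → α r * (1# + P r) * gaussTerm r l) N) M
        ≈⟨ anti-assoc (λ r l _ → α r * (1# + P r) * gaussTerm r l) M ⟩
      anti (λ r b → anti (λ l _ → α r * (1# + P r) * gaussTerm r l) b) M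
        ≈⟨ anti-cong M (λ r b → trans (sym (anti-*ˡ _ _ b)) (*-assoc _ _ _)) ⟩
      anti (λ r b → α r * ((1# + P r) * gaussSum r b)) M ∎

  -- `δ` keeps only N = 0, where `half` cancels 1 + p^0.
  multiSum-unit : ∀ M → multiSum 0 0 M ≈ 1#
  multiSum-unit zero = begin
    half * ((1# + P 0) * 1#)  ≈⟨ *-congˡ (*-congʳ (+-congˡ P-0)) ⟩
    half * ((1# + 1#) * 1#)   ≈⟨ solve 1 (λ h → h :* ((:1 :+ :1) :* :1) := h :+ h) refl half ⟩
    half + half               ≈⟨ half-law ⟩
    1#                        ∎
  multiSum-unit (suc M) = begin
    multiSum 0 0 (suc M)                                      ≈⟨ sumTo-snoc (λ N → w N * outerSum 0 0 N) M ⟩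
    multiSum 0 0 M + w (suc M) * ((1# + P (suc M)) * 0#)      ≈⟨ +-cong (multiSum-unit M) (trans (*-congˡ (zeroʳ _)) (zeroʳ _)) ⟩
    1# + 0#                                                   ≈⟨ +-identityʳ _ ⟩
    1#                                                        ∎

  -- Dividing by the case k = i = 1, where the multisum is 1, evaluates gaussSum 0 without the
  -- q-Gauss summation theorem.
  multiSum-theta-unit : ∀ m j M → multiSum m j M * theta 0 0 M ≈ theta m j M [mod suc M ]
  multiSum-theta-unit m j M = mod-trans (mod-* (multiSum-theta m j M) mod-refl)
    (mod-trans (mod-of-≈ (solve 3 (λ a g b → a :* g :* b := a :* (b :* g)) refl _ _ _))
      (mod-trans (mod-*ˡ _ (mod-trans (mod-sym (multiSum-theta 0 0 M)) (mod-of-≈ (multiSum-unit M))))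
                 (mod-of-≈ (*-identityʳ _))))

-- Jacobi's triple product, first finite and then modulo q^m.

module TripleProduct {c ℓ} (𝓡 : QRing c ℓ) where
  open QRing 𝓡
  open CommutativeRing R
  open PowerCongruence R q
  open Antidiagonal R
  open IntegerSolver R
  open import Relation.Binary.Reasoning.Setoid setoid

  -- poch s e b n = (s q^e; q^b)_n
  poch : Carrier → ℕ → ℕ → ℕ → Carrier
  poch s e b zero    = 1#
  poch s e b (suc n) = poch s e b n * (1# - s * q^ (e ℕ.+ b ℕ.* n))

  poch-stable : ∀ s e b n d → poch s e (suc b) (n ℕ.+ d) ≈ poch s e (suc b) n [mod n ]
  poch-stable s e b n zero = mod-of-≈ (reflexive (≡.cong (poch s e (suc b)) (ℕ.+-identityʳ n)))
  poch-stable s e b n (suc d) = mod-trans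
    (mod-of-≈ (trans (reflexive (≡.cong (poch s e (suc b)) (ℕ.+-suc n d)))
      (*-congˡ (solve 2 (λ s t → :1 :- s :* t := :1 :+ (:- s) :* t) refl _ _))))
    (mod-trans (mod-* (poch-stable s e b n d) (mod-+ mod-refl (mod-*ˡ _ (mod-weaken n≤ (1# , sym (trans (+-identityˡ _) (*-identityʳ _)))))))
      (mod-of-≈ (trans (*-congˡ (trans (+-congˡ (zeroʳ _)) (+-identityʳ _))) (*-identityʳ _))))
    where
    n≤ : n ℕ.≤ e ℕ.+ suc b ℕ.* (n ℕ.+ d)
    n≤ = ℕ.≤-trans (ℕ.m≤m+n n d) (ℕ.≤-trans (ℕ.m≤m+n (n ℕ.+ d) _) (ℕ.m≤n+m _ e))

  module Theta (b x y : ℕ) (x+y≡b : suc x ℕ.+ suc y ≡ suc b) where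
    open InverseFactorial 𝓡 b public

    X Y : Carrier
    X = q^ (suc x)
    Y = q^ (suc y)

    XY : X * Y ≈ P 1
    XY = trans (sym (q^-+ (suc x) (suc y))) (trans (q^-cong (≡.trans x+y≡b (≡.sym (ℕ.*-identityʳ (suc b))))) (sym (P-def 1)))

    pochX pochY : ℕ → Carrier
    pochX = poch 1# (suc x) (suc b)
    pochY = poch 1# (suc y) (suc b)

    factor : ∀ e n → 1# - 1# * q^ (e ℕ.+ suc b ℕ.* n) ≈ 1# - q^ e * P n
    factor e n = +-congˡ (-‿cong (trans (*-identityˡ _) (trans (q^-+ e (suc b ℕ.* n)) (*-congˡ (sym (P-def n))))))

    fac-poch : ∀ n → fac n ≈ poch 1# (suc b) (suc b) n
    fac-poch zero    = fac-0
    fac-poch (suc n) = trans (fac-suc n) (*-cong (fac-poch n)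
      (+-congˡ (-‿cong (trans (P-def (suc n)) (trans (q^-cong (ℕ.*-suc (suc b) n)) (sym (*-identityˡ _)))))))

    -- T m j = (-1)^r X^r Q^(r(r-1)/2) with r = j - m, where Q = XY.
    T : ℕ → ℕ → Carrier
    T zero    zero    = 1#
    T (suc m) zero    = - (Y * P m * T m 0)
    T zero    (suc j) = - (X * P j * T 0 j)
    T (suc m) (suc j) = T m j

    -- Lowering r = j - m by one divides by -X Q^(r-1). Multiplied by Q^j, and with Q = XY, the
    -- quotient becomes -Y Q^m.
    T-step : ∀ m j → P j * T (suc m) j ≈ - (Y * P m * T m j)
    T-step m zero = trans (*-congʳ P-0) (*-identityˡ _)
    T-step zero (suc j) = begin
      P (suc j) * T 0 j                        ≈⟨ *-congʳ (trans (P-suc j) (*-congʳ (sym XY))) ⟩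
      X * Y * P j * T 0 j                      ≈⟨ solve 4 (λ x y p t → x :* y :* p :* t := :- (y :* :1 :* (:- (x :* p :* t)))) refl _ _ _ _ ⟩
      - (Y * 1# * (- (X * P j * T 0 j)))       ≈⟨ -‿cong (*-congʳ (*-congˡ (sym P-0))) ⟩
      - (Y * P 0 * (- (X * P j * T 0 j)))      ∎
    T-step (suc m) (suc j) = begin
      P (suc j) * T (suc m) j                  ≈⟨ trans (*-congʳ (P-suc j)) (*-assoc _ _ _) ⟩
      P 1 * (P j * T (suc m) j)                ≈⟨ *-congˡ (T-step m j) ⟩
      P 1 * (- (Y * P m * T m j))              ≈⟨ solve 4 (λ z y p t → z :* (:- (y :* p :* t)) := :- (y :* (z :* p) :* t)) refl _ _ _ _ ⟩
      - (Y * (P 1 * P m) * T m j)              ≈⟨ -‿cong (*-congʳ (*-congˡ (sym (P-suc m)))) ⟩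
      - (Y * P (suc m) * T m j)                ∎

    term : ℕ → ℕ → ℕ → Carrier
    term m j l = T m j * (iv j * iv l)

    -- The q-binomial theorem, starting point of the finite triple product; as for
    -- q-Chu-Vandermonde, 1 - Q^(j+l) is split in two.
    qBinomial : ∀ n → anti (term 0) n ≈ pochX n * iv n
    qBinomial zero = *-congˡ (trans (*-congˡ iv-0) (*-identityʳ _))
    qBinomial (suc n) = cancel n (begin
      (1# - P (suc n)) * anti (term 0) (suc n)
        ≈⟨ anti-*ˡ _ (term 0) (suc n) ⟩
      anti (λ j l → (1# - P (suc n)) * term 0 j l) (suc n)
        ≈⟨ anti-cong′ (suc n) split ⟩
      anti (λ j l → A j l + B j l) (suc n)
        ≈⟨ anti-+ A B (suc n) ⟩
      anti A (suc n) + (B 0 (suc n) + anti (λ j l → B (suc j) l) n)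
        ≈⟨ +-cong (trans (anti-snoc A n) (+-cong (anti-cong n A-suc) A-0)) (+-cong B-0 (anti-cong′ n B-suc)) ⟩
      (anti (term 0) n + 0#) + (0# + anti (λ j l → - (X * P n) * term 0 j l) n)
        ≈⟨ +-cong (+-identityʳ _) (trans (+-identityˡ _) (sym (anti-*ˡ _ (term 0) n))) ⟩
      anti (term 0) n + - (X * P n) * anti (term 0) n
        ≈⟨ solve 2 (λ s x → s :+ (:- x) :* s := (:1 :- x) :* s) refl _ _ ⟩
      (1# - X * P n) * anti (term 0) n
        ≈⟨ *-cong (sym (factor (suc x) n)) (qBinomial n) ⟩
      (1# - 1# * q^ (suc x ℕ.+ suc b ℕ.* n)) * (pochX n * iv n)
        ≈⟨ *-congˡ (*-congˡ (sym (iv-suc n))) ⟩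
      (1# - 1# * q^ (suc x ℕ.+ suc b ℕ.* n)) * (pochX n * ((1# - P (suc n)) * iv (suc n)))
        ≈⟨ solve 4 (λ a p c i → a :* (p :* (c :* i)) := c :* (p :* a :* i)) refl _ _ _ _ ⟩
      (1# - P (suc n)) * (pochX (suc n) * iv (suc n)) ∎)
      where
      A B : ℕ → ℕ → Carrier
      A j l = (1# - P l) * term 0 j l
      B j l = P l * ((1# - P j) * term 0 j l)
      split : ∀ j l → j ℕ.+ l ≡ suc n → (1# - P (suc n)) * term 0 j l ≈ A j l + B j l
      split j l e = trans (*-congʳ (+-congˡ (-‿cong (trans (P-cong (≡.sym e)) (P-+ j l)))))
        (solve 3 (λ x y t → (:1 :- x :* y) :* t := (:1 :- y) :* t :+ y :* ((:1 :- x) :* t)) refl (P j) (P l) _)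
      A-0 : A (suc n) 0 ≈ 0#
      A-0 = trans (*-congʳ 1-P0≈0) (zeroˡ _)
      B-0 : B 0 (suc n) ≈ 0#
      B-0 = trans (*-congˡ (trans (*-congʳ 1-P0≈0) (zeroˡ _))) (zeroʳ _)
      A-suc : ∀ j l → A j (suc l) ≈ term 0 j l
      A-suc j l = trans (solve 4 (λ a t i k → a :* (t :* (i :* k)) := t :* (i :* (a :* k))) refl _ _ _ _)
                        (*-congˡ (*-congˡ (iv-suc l)))
      B-suc : ∀ j l → j ℕ.+ l ≡ n → B (suc j) l ≈ - (X * P n) * term 0 j l
      B-suc j l e = begin
        P l * ((1# - P (suc j)) * (- (X * P j * T 0 j) * (iv (suc j) * iv l)))
          ≈⟨ solve 7 (λ pl a x pj t i k → pl :* (a :* ((:- (x :* pj :* t)) :* (i :* k))) := (:- (x :* (pj :* pl))) :* (t :* ((a :* i) :* k))) refl _ _ _ _ _ _ _ ⟩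
        - (X * (P j * P l)) * (T 0 j * ((1# - P (suc j)) * iv (suc j) * iv l))
          ≈⟨ *-cong (-‿cong (*-congˡ (trans (sym (P-+ j l)) (P-cong e)))) (*-congˡ (*-congʳ (iv-suc j))) ⟩
        - (X * P n) * term 0 j l ∎

    -- Induction on m with the split 1 - Q^(j+l) = (1 - Q^j) + Q^j (1 - Q^l): the first part shifts
    -- j, which undoes the shift of m in `T`, and the second is governed by `T-step`.
    finiteTripleProduct : ∀ m n → anti (term m) (m ℕ.+ n) ≈ pochX n * pochY m * iv (m ℕ.+ n)
    finiteTripleProduct zero n = trans (qBinomial n) (*-congʳ (sym (*-identityʳ _)))
    finiteTripleProduct (suc m) n = cancel N (begin
      (1# - P (suc N)) * anti (term (suc m)) (suc N)
        ≈⟨ anti-*ˡ _ (term (suc m)) (suc N) ⟩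
      anti (λ j l → (1# - P (suc N)) * term (suc m) j l) (suc N)
        ≈⟨ anti-cong′ (suc N) split ⟩
      anti (λ j l → A j l + B j l) (suc N)
        ≈⟨ anti-+ A B (suc N) ⟩
      (A 0 (suc N) + anti (λ j l → A (suc j) l) N) + anti B (suc N)
        ≈⟨ +-cong (+-cong A-0 (anti-cong N A-suc)) (trans (anti-snoc B N) (+-cong (anti-cong N B-suc) B-0)) ⟩
      (0# + anti (term m) N) + (anti (λ j l → - (Y * P m) * term m j l) N + 0#)
        ≈⟨ +-cong (+-identityˡ _) (trans (+-identityʳ _) (sym (anti-*ˡ _ (term m) N))) ⟩
      anti (term m) N + - (Y * P m) * anti (term m) N
        ≈⟨ solve 2 (λ s x → s :+ (:- x) :* s := (:1 :- x) :* s) refl _ _ ⟩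
      (1# - Y * P m) * anti (term m) N
        ≈⟨ *-cong (sym (factor (suc y) m)) (trans (finiteTripleProduct m n) (*-congˡ (sym (iv-suc N)))) ⟩
      (1# - 1# * q^ (suc y ℕ.+ suc b ℕ.* m)) * (pochX n * pochY m * ((1# - P (suc N)) * iv (suc N)))
        ≈⟨ solve 5 (λ a p r c i → a :* (p :* r :* (c :* i)) := c :* (p :* (r :* a) :* i)) refl _ _ _ _ _ ⟩
      (1# - P (suc N)) * (pochX n * pochY (suc m) * iv (suc N)) ∎)
      where
      N = m ℕ.+ n
      A B : ℕ → ℕ → Carrier
      A j l = (1# - P j) * term (suc m) j l
      B j l = P j * ((1# - P l) * term (suc m) j l)
      split : ∀ j l → j ℕ.+ l ≡ suc N → (1# - P (suc N)) * term (suc m) j l ≈ A j l + B j l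
      split j l e = trans (*-congʳ (+-congˡ (-‿cong (trans (P-cong (≡.sym e)) (P-+ j l)))))
        (solve 3 (λ x y t → (:1 :- x :* y) :* t := (:1 :- x) :* t :+ x :* ((:1 :- y) :* t)) refl (P j) (P l) _)
      A-0 : A 0 (suc N) ≈ 0#
      A-0 = trans (*-congʳ 1-P0≈0) (zeroˡ _)
      B-0 : B (suc N) 0 ≈ 0#
      B-0 = trans (*-congˡ (trans (*-congʳ 1-P0≈0) (zeroˡ _))) (zeroʳ _)
      A-suc : ∀ j l → A (suc j) l ≈ term m j l
      A-suc j l = trans (solve 4 (λ a t i k → a :* (t :* (i :* k)) := t :* ((a :* i) :* k)) refl _ _ _ _)
                        (*-congˡ (*-congʳ (iv-suc j)))
      B-suc : ∀ j l → B j (suc l) ≈ - (Y * P m) * term m j l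
      B-suc j l = begin
        P j * ((1# - P (suc l)) * (T (suc m) j * (iv j * iv (suc l))))
          ≈⟨ solve 5 (λ p a t i k → p :* (a :* (t :* (i :* k))) := p :* t :* (i :* (a :* k))) refl _ _ _ _ _ ⟩
        P j * T (suc m) j * (iv j * ((1# - P (suc l)) * iv (suc l)))
          ≈⟨ *-cong (T-step m j) (*-congˡ (iv-suc l)) ⟩
        - (Y * P m * T m j) * (iv j * iv l)
          ≈⟨ solve 3 (λ y t i → (:- (y :* t)) :* i := (:- y) :* (t :* i)) refl _ _ _ ⟩
        - (Y * P m) * term m j l ∎

    fac-iv-mod : ∀ j d → fac (j ℕ.+ d) * iv j ≈ 1# [mod j ]
    fac-iv-mod j zero = mod-of-≈ (trans (*-congʳ (reflexive (≡.cong fac (ℕ.+-identityʳ j)))) (fac-iv j))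
    fac-iv-mod j (suc d) = mod-trans (mod-of-≈ (begin
        fac (j ℕ.+ suc d) * iv j                              ≈⟨ *-congʳ (trans (reflexive (≡.cong fac (ℕ.+-suc j d))) (fac-suc _)) ⟩
        fac (j ℕ.+ d) * (1# - P (suc (j ℕ.+ d))) * iv j       ≈⟨ solve 3 (λ f p i → f :* (:1 :- p) :* i := (f :* i) :* (:1 :+ (:- :1) :* p)) refl _ _ _ ⟩
        fac (j ℕ.+ d) * iv j * (1# + - 1# * P (suc (j ℕ.+ d))) ∎))
      (mod-trans (mod-* (fac-iv-mod j d) (mod-+ mod-refl (mod-*ˡ _ (mod-weaken (ℕ.≤-trans (ℕ.m≤m+n j d) (ℕ.n≤1+n _)) (P-mod (suc (j ℕ.+ d)))))))
        (mod-of-≈ (trans (*-identityˡ _) (trans (+-congˡ (zeroʳ _)) (+-identityʳ _)))))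

    fac-double-mod : ∀ m → fac (m ℕ.+ m) ≈ fac m [mod m ]
    fac-double-mod m = mod-trans
      (mod-of-≈ (trans (sym (*-identityʳ _)) (trans (*-congˡ (sym (fac-iv m))) (solve 3 (λ a b c → a :* (b :* c) := a :* c :* b) refl _ _ _))))
      (mod-trans (mod-* (fac-iv-mod m m) mod-refl) (mod-of-≈ (*-identityˡ _)))

    -- Divisibility of `T m j` by q^|j-m|, which holds because |j-m| factors X or Y occur; the two
    -- inequalities replace the absolute value.
    record Order (m j : ℕ) : Set (c Level.⊔ ℓ) where
      constructor order
      field
        exponent   : ℕ
        m≤         : m ℕ.≤ exponent ℕ.+ j
        j≤         : j ℕ.≤ exponent ℕ.+ m
        divisible  : T m j ≈ 0# [mod exponent ]

    *-divisible : ∀ {u t n} → u ≈ 0# [mod 1 ] → ∀ p → t ≈ 0# [mod n ] → - (u * p * t) ≈ 0# [mod suc n ]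
    *-divisible {u} {t} {n} (d , e) p (d′ , e′) = - (d * p * d′) , (begin
      - (u * p * t)                                         ≈⟨ -‿cong (*-cong (*-congʳ (trans e (+-identityˡ _))) (trans e′ (+-identityˡ _))) ⟩
      - (q^ 1 * d * p * (q^ n * d′))                        ≈⟨ solve 5 (λ a d p b d′ → :- (a :* d :* p :* (b :* d′)) := (a :* b) :* (:- (d :* p :* d′))) refl _ _ _ _ _ ⟩
      q^ 1 * q^ n * (- (d * p * d′))                        ≈⟨ trans (*-congʳ (sym (q^-+ 1 n))) (sym (+-identityˡ _)) ⟩
      0# + q^ (suc n) * (- (d * p * d′))                    ∎)

    q^suc-mod : ∀ n → q^ (suc n) ≈ 0# [mod 1 ]
    q^suc-mod n = q^ n , trans (q^-+ 1 n) (sym (+-identityˡ _))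

    T-order : ∀ m j → Order m j
    T-order zero zero = order 0 ℕ.z≤n ℕ.z≤n (1# , trans (sym (*-identityʳ _)) (trans (*-congʳ (sym q^-0)) (sym (+-identityˡ _))))
    T-order (suc m) zero with T-order m 0
    ... | order e m≤ j≤ d = order (suc e) (ℕ.s≤s m≤) ℕ.z≤n (*-divisible (q^suc-mod y) (P m) d)
    T-order zero (suc j) with T-order 0 j
    ... | order e m≤ j≤ d = order (suc e) ℕ.z≤n (ℕ.s≤s j≤) (*-divisible (q^suc-mod x) (P j) d)
    T-order (suc m) (suc j) with T-order m j
    ... | order e m≤ j≤ d = order e (≡.subst (suc m ℕ.≤_) (≡.sym (ℕ.+-suc e j)) (ℕ.s≤s m≤))
                                    (≡.subst (suc j ℕ.≤_) (≡.sym (ℕ.+-suc e m)) (ℕ.s≤s j≤)) d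

    τ : ℕ → Carrier
    τ zero    = 1#
    τ (suc r) = T 0 (suc r) + T (suc r) 0

    T-diagonal : ∀ m k → T m (m ℕ.+ k) ≡ T 0 k
    T-diagonal zero    k = ≡.refl
    T-diagonal (suc m) k = T-diagonal m k

    -- Here j - m runs from -m to m, and passing to m + 1 adds one term at each end; `τ` pairs these
    -- two.
    sumTo-T : ∀ m → sumTo (T m) (m ℕ.+ m) ≈ sumTo τ m
    sumTo-T zero    = refl
    sumTo-T (suc m) = begin
      T (suc m) 0 + sumTo (T m) (m ℕ.+ suc m)
        ≈⟨ +-congˡ (trans (reflexive (≡.cong (sumTo (T m)) (ℕ.+-suc m m))) (sumTo-snoc (T m) (m ℕ.+ m))) ⟩
      T (suc m) 0 + (sumTo (T m) (m ℕ.+ m) + T m (suc (m ℕ.+ m)))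
        ≈⟨ +-congˡ (+-cong (sumTo-T m) (reflexive (≡.trans (≡.cong (T m) (≡.sym (ℕ.+-suc m m))) (T-diagonal m (suc m))))) ⟩
      T (suc m) 0 + (sumTo τ m + T 0 (suc m))
        ≈⟨ solve 3 (λ a b c → a :+ (b :+ c) := b :+ (c :+ a)) refl _ _ _ ⟩
      sumTo τ m + τ (suc m)
        ≈⟨ sumTo-snoc τ m ⟨
      sumTo τ (suc m) ∎

    -- Multiplied by (Q;Q)_{2m}², term j of the finite identity carries two factorial quotients that
    -- are 1 modulo q^min(j,l). The divisibility of `T m j` supplies the missing |j-m| powers.
    tripleProduct : ∀ m → sumTo τ m ≈ fac (m ℕ.+ m) * (pochX m * pochY m) [mod m ]
    tripleProduct m = mod-trans (mod-of-≈ (sym (sumTo-T m)))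
      (mod-trans (mod-sym (anti-mod (m ℕ.+ m) complete)) (mod-of-≈ (begin
        anti (λ j l → T m j * (F * iv j * (F * iv l))) (m ℕ.+ m)
          ≈⟨ anti-cong (m ℕ.+ m) (λ j l → solve 4 (λ t f i k → t :* (f :* i :* (f :* k)) := f :* f :* (t :* (i :* k))) refl _ _ _ _) ⟩
        anti (λ j l → F * F * term m j l) (m ℕ.+ m)
          ≈⟨ anti-*ˡ _ (term m) (m ℕ.+ m) ⟨
        F * F * anti (term m) (m ℕ.+ m)
          ≈⟨ *-congˡ (finiteTripleProduct m m) ⟩
        F * F * (pochX m * pochY m * iv (m ℕ.+ m))
          ≈⟨ solve 3 (λ f p i → f :* f :* (p :* i) := (f :* i) :* (f :* p)) refl _ _ _ ⟩
        F * iv (m ℕ.+ m) * (F * (pochX m * pochY m))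
          ≈⟨ trans (*-congʳ (fac-iv (m ℕ.+ m))) (*-identityˡ _) ⟩
        F * (pochX m * pochY m) ∎)))
      where
      F = fac (m ℕ.+ m)
      complete : ∀ j l → j ℕ.+ l ≡ m ℕ.+ m → T m j * (F * iv j * (F * iv l)) ≈ T m j [mod m ]
      complete j l e with T-order m j
      ... | order k m≤ j≤ d = mod-trans
        (mod-shift (ℕ.m≤n+m∸n m k) d (mod-* (mod-weaken m∸k≤j facⱼ) (mod-weaken m∸k≤l facₗ)))
        (mod-of-≈ (trans (*-congˡ (*-identityˡ 1#)) (*-identityʳ _)))
        where
        facⱼ : F * iv j ≈ 1# [mod j ]
        facⱼ = ≡.subst (λ t → fac t * iv j ≈ 1# [mod j ]) e (fac-iv-mod j l)
        facₗ : F * iv l ≈ 1# [mod l ]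
        facₗ = ≡.subst (λ t → fac t * iv l ≈ 1# [mod l ]) (≡.trans (ℕ.+-comm l j) e) (fac-iv-mod l j)
        m∸k≤j : m ∸ k ℕ.≤ j
        m∸k≤j = ℕ.m≤n+o⇒m∸n≤o m k m≤
        m≤k+l : m ℕ.≤ k ℕ.+ l
        m≤k+l = ℕ.+-cancelʳ-≤ m m (k ℕ.+ l)
          (≡.subst₂ ℕ._≤_ e (swap k m l) (ℕ.+-monoˡ-≤ l j≤))
          where
          swap : ∀ k m l → k ℕ.+ m ℕ.+ l ≡ k ℕ.+ l ℕ.+ m
          swap = solve-∀
        m∸k≤l : m ∸ k ℕ.≤ l
        m∸k≤l = ℕ.m≤n+o⇒m∸n≤o m k m≤k+l

-- From the theta series to the product side.

module ProductSide {c ℓ} (𝓡 : QRing c ℓ) where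
  open QRing 𝓡
  open CommutativeRing R
  open PowerCongruence R q
  open Antidiagonal R
  open IntegerSolver R
  open BaileyChain 𝓡
  open TripleProduct 𝓡
  open import Relation.Binary.Reasoning.Setoid setoid
  open InverseFactorial 𝓡 1

  module _ (m j : ℕ) where
    -- For m = k - i and j = i - 1, the successors of x, y, b are 2i - 1, 4k - 1 - 2i and 4k - 2.
    -- The form of b makes `suc x + suc y` equal to `suc b` by computation.
    x y b : ℕ
    x = j ℕ.+ j
    y = j ℕ.+ j ℕ.+ 4 ℕ.* m
    b = x ℕ.+ suc y

    module Θ = Theta b x y ≡.refl

    T-Y : ∀ r → Θ.T r 0 ≈ P (j ℕ.* (r ℕ.* r)) * c-coeff m r * q^ r
    T-Y zero = sym (trans (*-cong (trans (*-congʳ (trans (P-cong (ℕ.*-zeroʳ j)) P-0)) (*-identityˡ _)) q^-0) (*-identityˡ _))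
    T-Y (suc r) = begin
      - (Θ.Y * Θ.P r * Θ.T r 0)
        ≈⟨ -‿cong (*-cong (*-congˡ (Θ.P-def r)) (trans (T-Y r) (*-congʳ (*-congʳ (P-def _))))) ⟩
      - (q^ (suc y) * q^ (suc b ℕ.* r) * (q^ (2 ℕ.* (j ℕ.* (r ℕ.* r))) * c-coeff m r * q^ r))
        ≈⟨ -‿cong (solve 5 (λ a b d c e → a :* b :* (d :* c :* e) := (a :* b :* d :* e) :* c) refl _ _ _ _ _) ⟩
      - (q^ (suc y) * q^ (suc b ℕ.* r) * q^ (2 ℕ.* (j ℕ.* (r ℕ.* r))) * q^ r * c-coeff m r)
        ≈⟨ -‿cong (*-congʳ (trans (*-congʳ (trans (*-congʳ (sym (q^-+ _ _))) (sym (q^-+ _ _)))) (sym (q^-+ _ _)))) ⟩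
      - (q^ (suc y ℕ.+ suc b ℕ.* r ℕ.+ 2 ℕ.* (j ℕ.* (r ℕ.* r)) ℕ.+ r) * c-coeff m r)
        ≈⟨ -‿cong (*-congʳ (q^-cong (exponent j m r))) ⟩
      - (q^ (2 ℕ.* (j ℕ.* (suc r ℕ.* suc r)) ℕ.+ 2 ℕ.* (r ℕ.+ (m ℕ.+ m) ℕ.* suc r) ℕ.+ suc r) * c-coeff m r)
        ≈⟨ -‿cong (*-congʳ (trans (q^-+ _ _) (*-congʳ (q^-+ _ _)))) ⟩
      - (q^ (2 ℕ.* (j ℕ.* (suc r ℕ.* suc r))) * q^ (2 ℕ.* (r ℕ.+ (m ℕ.+ m) ℕ.* suc r)) * q^ (suc r) * c-coeff m r)
        ≈⟨ solve 4 (λ a b d c → :- (a :* b :* d :* c) := a :* (:- (b :* c)) :* d) refl _ _ _ _ ⟩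
      q^ (2 ℕ.* (j ℕ.* (suc r ℕ.* suc r))) * (- (q^ (2 ℕ.* (r ℕ.+ (m ℕ.+ m) ℕ.* suc r)) * c-coeff m r)) * q^ (suc r)
        ≈⟨ *-congʳ (*-cong (P-def _) (-‿cong (*-congʳ (P-def _)))) ⟨
      P (j ℕ.* (suc r ℕ.* suc r)) * c-coeff m (suc r) * q^ (suc r) ∎
      where
      exponent : ∀ j m r → suc (j ℕ.+ j ℕ.+ 4 ℕ.* m) ℕ.+ suc (j ℕ.+ j ℕ.+ suc (j ℕ.+ j ℕ.+ 4 ℕ.* m)) ℕ.* r ℕ.+ 2 ℕ.* (j ℕ.* (r ℕ.* r)) ℕ.+ r
        ≡ 2 ℕ.* (j ℕ.* (suc r ℕ.* suc r)) ℕ.+ 2 ℕ.* (r ℕ.+ (m ℕ.+ m) ℕ.* suc r) ℕ.+ suc r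
      exponent = solve-∀

    T-X : ∀ r → Θ.T 0 (suc r) ≈ - (P (j ℕ.* (suc r ℕ.* suc r)) * (P r * c-coeff m r) * q^ (suc r))
    T-X zero = -‿cong (begin
      Θ.X * Θ.P 0 * 1#                    ≈⟨ trans (*-identityʳ _) (trans (*-congˡ Θ.P-0) (*-identityʳ _)) ⟩
      q^ (suc x)                          ≈⟨ q^-cong (exponent j) ⟩
      q^ (2 ℕ.* (j ℕ.* 1) ℕ.+ 1)          ≈⟨ q^-+ _ _ ⟩
      q^ (2 ℕ.* (j ℕ.* 1)) * q^ 1         ≈⟨ *-congʳ (trans (*-cong (P-def _) (trans (*-identityʳ _) P-0)) (*-identityʳ _)) ⟨
      P (j ℕ.* 1) * (P 0 * 1#) * q^ 1     ∎)
      where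
      exponent : ∀ j → suc (j ℕ.+ j) ≡ 2 ℕ.* (j ℕ.* 1) ℕ.+ 1
      exponent = solve-∀
    T-X (suc r) = begin
      - (Θ.X * Θ.P (suc r) * Θ.T 0 (suc r))
        ≈⟨ -‿cong (*-cong (*-congˡ (Θ.P-def (suc r))) (trans (T-X r) (-‿cong (*-congʳ (*-cong (P-def _) (*-congʳ (P-def r))))))) ⟩
      - (q^ (suc x) * q^ (suc b ℕ.* suc r) * (- (q^ (2 ℕ.* (j ℕ.* (suc r ℕ.* suc r))) * (q^ (2 ℕ.* r) * c-coeff m r) * q^ (suc r))))
        ≈⟨ solve 6 (λ a b d e c f → :- (a :* b :* (:- (d :* (e :* c) :* f))) := (a :* b :* d :* e :* f) :* c) refl _ _ _ _ _ _ ⟩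
      q^ (suc x) * q^ (suc b ℕ.* suc r) * q^ (2 ℕ.* (j ℕ.* (suc r ℕ.* suc r))) * q^ (2 ℕ.* r) * q^ (suc r) * c-coeff m r
        ≈⟨ *-congʳ (trans (*-congʳ (trans (*-congʳ (trans (*-congʳ (sym (q^-+ _ _))) (sym (q^-+ _ _)))) (sym (q^-+ _ _)))) (sym (q^-+ _ _))) ⟩
      q^ (suc x ℕ.+ suc b ℕ.* suc r ℕ.+ 2 ℕ.* (j ℕ.* (suc r ℕ.* suc r)) ℕ.+ 2 ℕ.* r ℕ.+ suc r) * c-coeff m r
        ≈⟨ *-congʳ (q^-cong (exponent j m r)) ⟩
      q^ (2 ℕ.* (j ℕ.* (suc (suc r) ℕ.* suc (suc r))) ℕ.+ 2 ℕ.* suc r ℕ.+ 2 ℕ.* (r ℕ.+ (m ℕ.+ m) ℕ.* suc r) ℕ.+ suc (suc r)) * c-coeff m r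
        ≈⟨ *-congʳ (trans (q^-+ _ _) (*-congʳ (trans (q^-+ _ _) (*-congʳ (q^-+ _ _))))) ⟩
      q^ (2 ℕ.* (j ℕ.* (suc (suc r) ℕ.* suc (suc r)))) * q^ (2 ℕ.* suc r) * q^ (2 ℕ.* (r ℕ.+ (m ℕ.+ m) ℕ.* suc r)) * q^ (suc (suc r)) * c-coeff m r
        ≈⟨ solve 5 (λ a b d e c → a :* b :* d :* e :* c := :- (a :* (b :* (:- (d :* c))) :* e)) refl _ _ _ _ _ ⟩
      - (q^ (2 ℕ.* (j ℕ.* (suc (suc r) ℕ.* suc (suc r)))) * (q^ (2 ℕ.* suc r) * (- (q^ (2 ℕ.* (r ℕ.+ (m ℕ.+ m) ℕ.* suc r)) * c-coeff m r))) * q^ (suc (suc r)))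
        ≈⟨ -‿cong (*-congʳ (*-cong (P-def _) (*-cong (P-def _) (-‿cong (*-congʳ (P-def _)))))) ⟨
      - (P (j ℕ.* (suc (suc r) ℕ.* suc (suc r))) * (P (suc r) * c-coeff m (suc r)) * q^ (suc (suc r))) ∎
      where
      exponent : ∀ j m r → suc (j ℕ.+ j) ℕ.+ suc (j ℕ.+ j ℕ.+ suc (j ℕ.+ j ℕ.+ 4 ℕ.* m)) ℕ.* suc r ℕ.+ 2 ℕ.* (j ℕ.* (suc r ℕ.* suc r)) ℕ.+ 2 ℕ.* r ℕ.+ suc r
        ≡ 2 ℕ.* (j ℕ.* (suc (suc r) ℕ.* suc (suc r))) ℕ.+ 2 ℕ.* suc r ℕ.+ 2 ℕ.* (r ℕ.+ (m ℕ.+ m) ℕ.* suc r) ℕ.+ suc (suc r)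
      exponent = solve-∀

    thetaTerm-τ : ∀ r → thetaTerm m j r ≈ Θ.τ r
    thetaTerm-τ zero    = sym (T-Y 0)
    thetaTerm-τ (suc r) = trans (solve 4 (λ p c d u → p :* (c :- d) :* u := :- (p :* d :* u) :+ p :* c :* u) refl _ _ _ _)
                                (sym (+-cong (T-X r) (T-Y (suc r))))

    theta-product : ∀ M → theta m j M ≈ Θ.fac (M ℕ.+ M) * (Θ.pochX M * Θ.pochY M) [mod M ]
    theta-product M = mod-trans (mod-of-≈ (anti-cong M (λ r _ → thetaTerm-τ r))) (Θ.tripleProduct M)

  odd*even : ∀ n → poch 1# 1 2 n * fac n ≈ poch 1# 1 1 (n ℕ.+ n)
  odd*even zero    = trans (*-congˡ fac-0) (*-identityʳ _)
  odd*even (suc n) = begin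
    poch 1# 1 2 n * (1# - 1# * q^ (1 ℕ.+ 2 ℕ.* n)) * fac (suc n)
      ≈⟨ *-congˡ (trans (fac-suc n) (*-congˡ (+-congˡ (-‿cong (trans (P-def _) (trans (q^-cong (even n)) (sym (*-identityˡ _)))))))) ⟩
    poch 1# 1 2 n * (1# - 1# * q^ (1 ℕ.+ 2 ℕ.* n)) * (fac n * (1# - 1# * q^ (1 ℕ.+ 1 ℕ.* suc (n ℕ.+ n))))
      ≈⟨ solve 4 (λ a u f v → a :* u :* (f :* v) := a :* f :* u :* v) refl _ _ _ _ ⟩
    poch 1# 1 2 n * fac n * (1# - 1# * q^ (1 ℕ.+ 2 ℕ.* n)) * (1# - 1# * q^ (1 ℕ.+ 1 ℕ.* suc (n ℕ.+ n)))
      ≈⟨ *-congʳ (*-cong (odd*even n) (+-congˡ (-‿cong (*-congˡ (q^-cong (odd n)))))) ⟩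
    poch 1# 1 1 (suc (suc (n ℕ.+ n)))
      ≡⟨ ≡.cong (λ t → poch 1# 1 1 (suc t)) (≡.sym (ℕ.+-suc n n)) ⟩
    poch 1# 1 1 (suc n ℕ.+ suc n) ∎
    where
    even : ∀ n → 2 ℕ.* suc n ≡ 1 ℕ.+ 1 ℕ.* suc (n ℕ.+ n)
    even = solve-∀
    odd : ∀ n → 1 ℕ.+ 2 ℕ.* n ≡ 1 ℕ.+ 1 ℕ.* (n ℕ.+ n)
    odd = solve-∀

  neg*pos : ∀ n → poch (- 1#) 1 1 n * poch 1# 1 1 n ≈ fac n
  neg*pos zero    = trans (*-identityʳ _) (sym fac-0)
  neg*pos (suc n) = begin
    poch (- 1#) 1 1 n * (1# - - 1# * t) * (poch 1# 1 1 n * (1# - 1# * t))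
      ≈⟨ solve 3 (λ a b t → a :* (:1 :- (:- :1) :* t) :* (b :* (:1 :- :1 :* t)) := a :* b :* (:1 :- t :* t)) refl _ _ t ⟩
    poch (- 1#) 1 1 n * poch 1# 1 1 n * (1# - t * t)
      ≈⟨ *-cong (neg*pos n) (+-congˡ (-‿cong (trans (sym (q^-+ _ _)) (trans (q^-cong (double n)) (sym (P-def _)))))) ⟩
    fac n * (1# - P (suc n))
      ≈⟨ fac-suc n ⟨
    fac (suc n) ∎
    where
    t = q^ (1 ℕ.+ 1 ℕ.* n)
    double : ∀ n → (1 ℕ.+ 1 ℕ.* n) ℕ.+ (1 ℕ.+ 1 ℕ.* n) ≡ 2 ℕ.* suc n
    double = solve-∀

  -- For k = i = 1 the theta product is (q;q²)²(q²;q²)_∞, and (-q;q)_∞ (q;q²)_∞ = 1. So (q;q)_∞ may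
  -- be traded for (-q;q)_∞ times `theta 0 0`, after which `multiSum-theta-unit` applies.
  multiSum-product : ∀ m j M → multiSum m j M * poch 1# 1 1 (M ℕ.+ M)
    ≈ poch (- 1#) 1 1 (M ℕ.+ M) * (Θ.pochX m j M * (Θ.pochY m j M * poch 1# (suc (b m j)) (suc (b m j)) (M ℕ.+ M))) [mod M ]
  multiSum-product m j M =
    mod-trans (mod-of-≈ (trans (*-congˡ (sym (odd*even M))) (sym (*-congˡ (*-comm _ _)))))
    -- Doubling the length of the factorial lets `neg*pos` split off (-q;q)_{2M}; modulo q^M it
    -- changes nothing.
    (mod-trans (mod-*ˡ L (mod-* (mod-sym (Θ₀.fac-double-mod M)) mod-refl))
    (mod-trans (mod-of-≈ (trans (*-congˡ (*-congʳ (sym (neg*pos (M ℕ.+ M)))))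
      (trans (*-congˡ (*-congʳ (*-congˡ (sym (odd*even M))))) (solve 4 (λ l a o f → l :* (a :* (o :* f) :* o) := a :* (l :* (f :* (o :* o)))) refl L A O (fac M)))))
    (mod-trans (mod-*ˡ A (mod-*ˡ L (mod-trans (mod-* (mod-sym (Θ₀.fac-double-mod M)) mod-refl) (mod-sym (theta-product 0 0 M)))))
    (mod-trans (mod-*ˡ A (mod-trans (mod-weaken (ℕ.n≤1+n M) (multiSum-theta-unit m j M)) (theta-product m j M)))
    (mod-of-≈ (*-congˡ (trans (*-congʳ (Θ.fac-poch m j (M ℕ.+ M))) (solve 3 (λ f x y → f :* (x :* y) := x :* (y :* f)) refl _ _ _))))))))
    where
    module Θ₀ = Θ 0 0
    L = multiSum m j M
    A = poch (- 1#) 1 1 (M ℕ.+ M)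
    O = poch 1# 1 2 M

-- The sum over tuples as an iterated Bailey step.

module TupleSum {c ℓ} (𝓡 : QRing c ℓ) where
  open QRing 𝓡
  open CommutativeRing R
  open PowerCongruence R q
  open Antidiagonal R
  open IntegerSolver R
  open BaileyChain 𝓡
  open InverseFactorial 𝓡 1
  open import Relation.Binary.Reasoning.Setoid setoid

  sumList : ∀ {A : Set} → (A → Carrier) → List A → Carrier
  sumList f []       = 0#
  sumList f (x ∷ xs) = f x + sumList f xs

  sumList-++ : ∀ {A : Set} (f : A → Carrier) xs ys → sumList f (xs ++ ys) ≈ sumList f xs + sumList f ys
  sumList-++ f []       ys = sym (+-identityˡ _)
  sumList-++ f (x ∷ xs) ys = trans (+-congˡ (sumList-++ f xs ys)) (sym (+-assoc _ _ _))

  sumList-map : ∀ {A B : Set} (f : B → Carrier) (g : A → B) xs → sumList f (map g xs) ≈ sumList (λ x → f (g x)) xs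
  sumList-map f g []       = refl
  sumList-map f g (x ∷ xs) = +-congˡ (sumList-map f g xs)

  sumList-cong : ∀ {A : Set} {f g : A → Carrier} → (∀ x → f x ≈ g x) → ∀ xs → sumList f xs ≈ sumList g xs
  sumList-cong h []       = refl
  sumList-cong h (x ∷ xs) = +-cong (h x) (sumList-cong h xs)

  sumList-*ˡ : ∀ {A : Set} a (f : A → Carrier) xs → a * sumList f xs ≈ sumList (λ x → a * f x) xs
  sumList-*ˡ a f []       = zeroʳ a
  sumList-*ˡ a f (x ∷ xs) = trans (distribˡ _ _ _) (+-congˡ (sumList-*ˡ a f xs))

  sumList-concatMap : ∀ {A B : Set} (f : B → Carrier) (g : A → List B) xs →
    sumList f (concatMap g xs) ≈ sumList (λ x → sumList f (g x)) xs
  sumList-concatMap f g []       = refl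
  sumList-concatMap f g (x ∷ xs) = trans (sumList-++ f (g x) (concatMap g xs)) (+-congˡ (sumList-concatMap f g xs))

  sumList-applyUpTo : ∀ {A : Set} (f : A → Carrier) (g : ℕ → A) N →
    sumList f (applyUpTo g (suc N)) ≈ sumTo (λ j → f (g j)) N
  sumList-applyUpTo f g zero    = +-identityʳ _
  sumList-applyUpTo f g (suc N) = +-congˡ (sumList-applyUpTo f (λ j → g (suc j)) N)

  sumList-decTuples : ∀ (f : List ℕ → Carrier) n M →
    sumList f (decTuples (suc n) M) ≈ sumTo (λ a → sumList (λ as → f (a ∷ as)) (decTuples n a)) M
  sumList-decTuples f n M = begin
    sumList f (concatMap (λ a → map (a ∷_) (decTuples n a)) (upTo (suc M)))
      ≈⟨ sumList-concatMap f (λ a → map (a ∷_) (decTuples n a)) (upTo (suc M)) ⟩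
    sumList (λ a → sumList f (map (a ∷_) (decTuples n a))) (upTo (suc M))
      ≈⟨ sumList-cong (λ a → sumList-map f (a ∷_) (decTuples n a)) (upTo (suc M)) ⟩
    sumList (λ a → sumList (λ as → f (a ∷ as)) (decTuples n a)) (upTo (suc M))
      ≈⟨ sumList-applyUpTo _ _ M ⟩
    sumTo (λ a → sumList (λ as → f (a ∷ as)) (decTuples n a)) M ∎

  step : ℕ → ℕ → ℕ → Carrier
  step σ N a = P (a ℕ.* a ℕ.+ σ ℕ.* a) * iv (N ∸ a)

  -- At the empty tail N is the last entry N_{k-1}, and `iv N` is the factor of the step to N_k = 0.
  innerTerm : ℕ → List ℕ → Carrier
  innerTerm N []       = iv N
  innerTerm N (a ∷ as) = step 1 N a * innerTerm a as

  -- The summand without the factor w N₁; the index i′ is i - 1.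
  outerTerm : ℕ → ℕ → List ℕ → Carrier
  outerTerm zero     N as       = (1# + P N) * innerTerm N as
  -- The list ends before N_i is reached: the case i = k, with N_k = 0 and 1 + p^0 = 2.
  outerTerm (suc i′) N []       = (1# + 1#) * iv N
  outerTerm (suc i′) N (a ∷ as) = step 0 N a * outerTerm i′ a as

  sumTo-step : ∀ σ (β β′ : ℕ → Carrier) → (∀ a → β a ≈ β′ a) → ∀ N → sumTo (λ a → step σ N a * β a) N ≈ baileyStep σ β′ N
  sumTo-step σ β β′ h N = anti-cong′ N λ { a l ≡.refl → *-cong (*-congˡ (iv-cong (ℕ.m+n∸m≡n a l))) (h a) }

  anti-head : ∀ f → (∀ j l → f (suc j) l ≈ 0#) → ∀ N → anti f N ≈ f 0 N
  anti-head f h zero    = refl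
  anti-head f h (suc N) = trans (+-congˡ (trans (anti-cong N h) (anti-zero N))) (+-identityʳ _)

  baileyStep-δ : ∀ σ {β} x → β 0 ≈ x → (∀ a → β (suc a) ≈ 0#) → ∀ N → baileyStep σ β N ≈ x * iv N
  baileyStep-δ σ {β} x h₀ hₛ N = begin
    baileyStep σ β N                     ≈⟨ anti-head _ (λ a l → trans (*-congˡ (hₛ a)) (zeroʳ _)) N ⟩
    P (σ ℕ.* 0) * iv N * β 0             ≈⟨ *-cong (*-congʳ (trans (P-cong (ℕ.*-zeroʳ σ)) P-0)) h₀ ⟩
    1# * iv N * x                        ≈⟨ solve 2 (λ v x → :1 :* v :* x := x :* v) refl _ _ ⟩
    x * iv N                             ∎

  sumList-tail : ∀ σ N (f : ℕ → List ℕ → Carrier) β n → (∀ a → sumList (f a) (decTuples n a) ≈ β a) →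
    ∀ (g : List ℕ → Carrier) → (∀ a as → g (a ∷ as) ≡ step σ N a * f a as) →
    sumList g (decTuples (suc n) N) ≈ baileyStep σ β N
  sumList-tail σ N f β n h g g-def = begin
    sumList g (decTuples (suc n) N)
      ≈⟨ sumList-decTuples g n N ⟩
    sumTo (λ a → sumList (λ as → g (a ∷ as)) (decTuples n a)) N
      ≈⟨ anti-cong N (λ a _ → trans (sumList-cong (λ as → reflexive (g-def a as)) (decTuples n a)) (sym (sumList-*ˡ _ _ (decTuples n a)))) ⟩
    sumTo (λ a → step σ N a * sumList (f a) (decTuples n a)) N
      ≈⟨ sumTo-step σ _ β h N ⟩
    baileyStep σ β N ∎

  -- n entries give n + 1 steps, the extra one being the step to N_k = 0.
  sumList-innerTerm : ∀ n N → sumList (innerTerm N) (decTuples n N) ≈ innerSum (suc n) N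
  sumList-innerTerm zero N = trans (+-identityʳ _)
    (sym (trans (baileyStep-δ 1 1# refl (λ _ → refl) N) (*-identityˡ _)))
  sumList-innerTerm (suc n) N = sumList-tail 1 N innerTerm (innerSum (suc n)) n (sumList-innerTerm n) (innerTerm N) (λ _ _ → ≡.refl)

  sumList-outerTerm : ∀ n i′ → i′ ℕ.≤ suc n → ∀ N → sumList (outerTerm i′ N) (decTuples n N) ≈ outerSum (suc n ∸ i′) i′ N
  sumList-outerTerm n zero _ N = trans (sym (sumList-*ˡ _ _ (decTuples n N))) (*-congˡ (sumList-innerTerm n N))
  sumList-outerTerm zero (suc zero) _ N = trans (+-identityʳ _)
    (sym (baileyStep-δ 0 (1# + 1#) (trans (*-identityʳ _) (+-congˡ P-0)) (λ a → zeroʳ _) N))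
  sumList-outerTerm zero (suc (suc i′)) (ℕ.s≤s ())
  sumList-outerTerm (suc n) (suc i′) (ℕ.s≤s i′≤) N =
    sumList-tail 0 N (outerTerm i′) (outerSum (suc n ∸ i′) i′) n (sumList-outerTerm n i′ i′≤) (outerTerm (suc i′) N) (λ _ _ → ≡.refl)

  tupleTerm : ℕ → List ℕ → Carrier
  tupleTerm i′ []       = 0#
  tupleTerm i′ (N ∷ as) = w N * outerTerm i′ N as

  sumList-tupleTerm : ∀ n i′ → i′ ℕ.≤ suc n → ∀ M → sumList (tupleTerm i′) (decTuples (suc n) M) ≈ multiSum (suc n ∸ i′) i′ M
  sumList-tupleTerm n i′ i′≤ M = trans (sumList-decTuples (tupleTerm i′) n M)
    (anti-cong M (λ N _ → trans (sym (sumList-*ˡ _ _ (decTuples n N))) (*-congˡ (sumList-outerTerm n i′ i′≤ N))))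

  denominator : ℕ → List ℕ → Carrier
  denominator N []       = iv N
  denominator N (a ∷ as) = iv (N ∸ a) * denominator a as

  squares : List ℕ → ℕ
  squares as = sum (map (λ a → a ℕ.* a) as)

  q^-step : ∀ a N s d {x y} → 2 ℕ.* (a ℕ.* a ℕ.+ d) ℕ.+ s ≡ x → ∀ z → z ≈ q^ s * y →
    P (a ℕ.* a ℕ.+ d) * iv N * z ≈ q^ x * (iv N * y)
  q^-step a N s d {x} {y} e z h = begin
    P (a ℕ.* a ℕ.+ d) * iv N * z                        ≈⟨ *-cong (*-congʳ (P-def _)) h ⟩
    q^ (2 ℕ.* (a ℕ.* a ℕ.+ d)) * iv N * (q^ s * y)      ≈⟨ solve 4 (λ a i s y → a :* i :* (s :* y) := a :* s :* (i :* y)) refl _ _ _ _ ⟩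
    q^ (2 ℕ.* (a ℕ.* a ℕ.+ d)) * q^ s * (iv N * y)      ≈⟨ *-congʳ (trans (sym (q^-+ _ _)) (q^-cong e)) ⟩
    q^ x * (iv N * y)                                   ∎

  innerTerm-monomial : ∀ N as → innerTerm N as ≈ q^ (2 ℕ.* (squares as ℕ.+ sum as)) * denominator N as
  innerTerm-monomial N []       = sym (trans (*-congʳ q^-0) (*-identityˡ _))
  innerTerm-monomial N (a ∷ as) = q^-step a (N ∸ a) (2 ℕ.* (squares as ℕ.+ sum as)) (1 ℕ.* a) (exponent a (squares as) (sum as)) _ (innerTerm-monomial a as)
    where
    exponent : ∀ a s t → 2 ℕ.* (a ℕ.* a ℕ.+ 1 ℕ.* a) ℕ.+ 2 ℕ.* (s ℕ.+ t) ≡ 2 ℕ.* (a ℕ.* a ℕ.+ s ℕ.+ (a ℕ.+ t))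
    exponent = solve-∀

  outerTerm-monomial : ∀ i′ N as → outerTerm i′ N as
    ≈ q^ (2 ℕ.* (squares as ℕ.+ sum (drop (suc i′) (N ∷ as)))) * ((1# + q^ (2 ℕ.* nth (N ∷ as) (suc i′))) * denominator N as)
  outerTerm-monomial zero N as = trans (*-cong (+-congˡ (P-def N)) (innerTerm-monomial N as))
    (solve 3 (λ a b c → a :* (b :* c) := b :* (a :* c)) refl _ _ _)
  outerTerm-monomial (suc i′) N [] = sym (trans (*-cong q^-0 (*-congʳ (+-congˡ q^-0))) (*-identityˡ _))
  outerTerm-monomial (suc i′) N (a ∷ as) = trans
    (q^-step a (N ∸ a) _ (0 ℕ.* a) (exponent a (squares as) (sum (drop (suc i′) (a ∷ as)))) _ (outerTerm-monomial i′ a as))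
    (*-congˡ (solve 3 (λ i n d → i :* (n :* d) := n :* (i :* d)) refl _ _ _))
    where
    exponent : ∀ a s t → 2 ℕ.* (a ℕ.* a ℕ.+ 0) ℕ.+ 2 ℕ.* (s ℕ.+ t) ≡ 2 ℕ.* (a ℕ.* a ℕ.+ s ℕ.+ t)
    exponent = solve-∀

  -- ∏_{t<n} (1 + q^(-o-2t)) = q^(-lowest o n) negProd o n
  lowest : ℕ → ℕ → ℕ
  lowest o zero    = 0
  lowest o (suc n) = (o ℕ.+ 2 ℕ.* n) ℕ.+ lowest o n

  negProd : ℕ → ℕ → Carrier
  negProd o zero    = 1#
  negProd o (suc n) = (1# + q^ (o ℕ.+ 2 ℕ.* n)) * negProd o n

  -- (-q^(2-2N);q²)_{N-1}; at N = 0 it is 1/(1 + q^0).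
  evenProd : ℕ → Carrier
  evenProd zero    = half
  evenProd (suc n) = negProd 2 n

  evenLowest : ℕ → ℕ
  evenLowest zero    = 0
  evenLowest (suc n) = lowest 2 n

  -- The two totals are N(N-1) and N²; the N left over from 2N² is the exponent of q^N in `w`.
  lowest-total : ∀ N → evenLowest N ℕ.+ lowest 1 N ℕ.+ N ≡ 2 ℕ.* (N ℕ.* N)
  lowest-total zero = ≡.refl
  lowest-total (suc zero) = ≡.refl
  lowest-total (suc (suc n)) = ≡.trans (regroup n (lowest 2 n) (lowest 1 (suc n)))
    (≡.trans (≡.cong (ℕ._+ (4 ℕ.* n ℕ.+ 6)) (lowest-total (suc n))) (square n))
    where
    regroup : ∀ n a b → (2 ℕ.+ 2 ℕ.* n ℕ.+ a) ℕ.+ (1 ℕ.+ 2 ℕ.* suc n ℕ.+ b) ℕ.+ suc (suc n) ≡ (a ℕ.+ b ℕ.+ suc n) ℕ.+ (4 ℕ.* n ℕ.+ 6)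
    regroup = solve-∀
    square : ∀ n → 2 ℕ.* (suc n ℕ.* suc n) ℕ.+ (4 ℕ.* n ℕ.+ 6) ≡ 2 ℕ.* (suc (suc n) ℕ.* suc (suc n))
    square = solve-∀

  w-product : ∀ N → w N ≈ q^ N * (evenProd N * negProd 1 N)
  w-product zero = sym (trans (*-congʳ q^-0) (trans (*-identityˡ _) (*-identityʳ _)))
  w-product (suc n) = begin
    q * (1# + P n) * (1# + q * P n) * w n
      ≈⟨ *-congˡ (w-product n) ⟩
    q * (1# + P n) * (1# + q * P n) * (q^ n * (evenProd n * negProd 1 n))
      ≈⟨ solve 6 (λ q a b x e o → q :* a :* b :* (x :* (e :* o)) := (q :* x) :* ((a :* e) :* (b :* o))) refl _ _ _ _ _ _ ⟩
    q * q^ n * ((1# + P n) * evenProd n * ((1# + q * P n) * negProd 1 n))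
      ≈⟨ *-cong (sym (q^-suc n)) (*-cong (even n) (*-congʳ (+-congˡ (trans (*-congˡ (P-def n)) (sym (q^-suc _)))))) ⟩
    q^ (suc n) * (negProd 2 n * negProd 1 (suc n)) ∎
    where
    even : ∀ n → (1# + P n) * evenProd n ≈ negProd 2 n
    even zero    = trans (*-congʳ (+-congˡ P-0)) (trans (solve 1 (λ h → (:1 :+ :1) :* h := h :+ h) refl half) half-law)
    even (suc n) = *-congʳ (+-congˡ (trans (P-def _) (q^-cong (ℕ.*-suc 2 n))))

  -- The left-hand side is the summand with numerator exponents as in the theorem, all of its
  -- negative powers of q cleared.
  tupleTerm-monomial : ∀ i′ N as →
    (evenProd N * (negProd 1 N * (q^ (2 ℕ.* (squares (N ∷ as) ℕ.+ sum (drop (suc i′) (N ∷ as))))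
      * ((1# + q^ (2 ℕ.* nth (N ∷ as) (suc i′))) * denominator N as))))
      ≈ q^ (evenLowest N ℕ.+ lowest 1 N) * tupleTerm i′ (N ∷ as)
  tupleTerm-monomial i′ N as = begin
    evenProd N * (negProd 1 N * (q^ (2 ℕ.* (N ℕ.* N ℕ.+ s ℕ.+ t)) * D))
      ≈⟨ *-congˡ (*-congˡ (*-congʳ (trans (q^-cong exponent) (trans (q^-+ _ _) (*-congʳ (q^-+ _ _)))))) ⟩
    evenProd N * (negProd 1 N * (q^ (evenLowest N ℕ.+ lowest 1 N) * q^ N * q^ (2 ℕ.* (s ℕ.+ t)) * D))
      ≈⟨ solve 6 (λ e o a n b d → e :* (o :* (a :* n :* b :* d)) := a :* (n :* (e :* o) :* (b :* d))) refl _ _ _ _ _ _ ⟩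
    q^ (evenLowest N ℕ.+ lowest 1 N) * (q^ N * (evenProd N * negProd 1 N) * (q^ (2 ℕ.* (s ℕ.+ t)) * D))
      ≈⟨ *-congˡ (*-cong (w-product N) (outerTerm-monomial i′ N as)) ⟨
    q^ (evenLowest N ℕ.+ lowest 1 N) * (w N * outerTerm i′ N as) ∎
    where
    s = squares as
    t = sum (drop (suc i′) (N ∷ as))
    D = (1# + q^ (2 ℕ.* nth (N ∷ as) (suc i′))) * denominator N as
    expand : ∀ n s t → 2 ℕ.* (n ℕ.+ s ℕ.+ t) ≡ 2 ℕ.* n ℕ.+ 2 ℕ.* (s ℕ.+ t)
    expand = solve-∀
    exponent : 2 ℕ.* (N ℕ.* N ℕ.+ s ℕ.+ t) ≡ evenLowest N ℕ.+ lowest 1 N ℕ.+ N ℕ.+ 2 ℕ.* (s ℕ.+ t)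
    exponent = ≡.trans (expand (N ℕ.* N) s t) (≡.cong (ℕ._+ 2 ℕ.* (s ℕ.+ t)) (≡.sym (lowest-total N)))

-- Formal power series as an instance of the abstract ring.

module ℚΣ = Antidiagonal ℚ.+-*-commutativeRing

infix 4 _≋_
record _≋_ (f g : FPS) : Set where
  constructor pointwise
  field coeff : ∀ n → f n ≡ g n
open _≋_

negF : FPS → FPS
negF f n = ℚ.- f n

sumBelow-sumTo : ∀ f n → sumBelow f (suc n) ≡ ℚΣ.sumTo f n
sumBelow-sumTo f zero    = ℚ.+-identityˡ (f 0)
sumBelow-sumTo f (suc n) = ≡.trans (≡.cong (ℚ._+ f (suc n)) (sumBelow-sumTo f n)) (≡.sym (ℚΣ.sumTo-snoc f n))

-- Removes the truncated subtraction from the Cauchy product, so that the ring laws reduce to those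
-- of `anti`.
*F-anti : ∀ f g n → (f *F g) n ≡ ℚΣ.anti (λ j l → f j ℚ.* g l) n
*F-anti f g n = ≡.trans (sumBelow-sumTo _ n)
  (ℚΣ.anti-cong′ n (λ { j l ≡.refl → ≡.cong (λ t → f j ℚ.* g t) (ℕ.m+n∸m≡n j l) }))

*F-cong : ∀ {f f′ g g′} → f ≋ f′ → g ≋ g′ → f *F g ≋ f′ *F g′
*F-cong {f} {f′} {g} {g′} p r = pointwise λ n → ≡.trans (*F-anti f g n)
  (≡.trans (ℚΣ.anti-cong n (λ j l → ≡.cong₂ ℚ._*_ (coeff p j) (coeff r l))) (≡.sym (*F-anti f′ g′ n)))

*F-comm : ∀ f g → f *F g ≋ g *F f
*F-comm f g = pointwise λ n → ≡.trans (*F-anti f g n) (≡.trans (ℚΣ.anti-swap _ n)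
  (≡.trans (ℚΣ.anti-cong n (λ j l → ℚ.*-comm (f l) (g j))) (≡.sym (*F-anti g f n))))

*F-assoc : ∀ f g h → (f *F g) *F h ≋ f *F (g *F h)
*F-assoc f g h = pointwise λ n → begin
  ((f *F g) *F h) n
    ≡⟨ *F-anti (f *F g) h n ⟩
  anti (λ a c → (f *F g) a ℚ.* h c) n
    ≡⟨ ℚΣ.anti-cong n (λ a c → ≡.trans (≡.cong (ℚ._* h c) (*F-anti f g a)) (ℚΣ.anti-*ʳ (h c) _ a)) ⟩
  anti (λ a c → anti (λ r l → f r ℚ.* g l ℚ.* h c) a) n
    ≡⟨ ℚΣ.anti-assoc (λ r l c → f r ℚ.* g l ℚ.* h c) n ⟩
  anti (λ r b → anti (λ l c → f r ℚ.* g l ℚ.* h c) b) n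
    ≡⟨ ℚΣ.anti-cong n (λ r b → ≡.trans (ℚΣ.anti-cong b (λ l c → ℚ.*-assoc (f r) (g l) (h c))) (≡.sym (ℚΣ.anti-*ˡ (f r) _ b))) ⟩
  anti (λ r b → f r ℚ.* anti (λ l c → g l ℚ.* h c) b) n
    ≡⟨ ℚΣ.anti-cong n (λ r b → ≡.cong (f r ℚ.*_) (≡.sym (*F-anti g h b))) ⟩
  anti (λ r b → f r ℚ.* (g *F h) b) n
    ≡⟨ *F-anti f (g *F h) n ⟨
  (f *F (g *F h)) n ∎
  where
  open ≡.≡-Reasoning
  open ℚΣ using (anti)

*F-identityˡ : ∀ f → oneF *F f ≋ f
*F-identityˡ f = pointwise λ n → ≡.trans (*F-anti oneF f n) (go n)
  where
  go : ∀ n → ℚΣ.anti (λ j l → oneF j ℚ.* f l) n ≡ f n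
  go zero    = ℚ.*-identityˡ (f 0)
  go (suc n) = ≡.trans (≡.cong₂ ℚ._+_ (ℚ.*-identityˡ (f (suc n)))
    (≡.trans (ℚΣ.anti-cong n (λ j l → ℚ.*-zeroˡ (f l))) (ℚΣ.anti-zero n))) (ℚ.+-identityʳ (f (suc n)))

*F-distribˡ : ∀ f g h → f *F (g +F h) ≋ (f *F g) +F (f *F h)
*F-distribˡ f g h = pointwise λ n → ≡.trans (*F-anti f (g +F h) n)
  (≡.trans (ℚΣ.anti-cong n (λ j l → ℚ.*-distribˡ-+ (f j) (g l) (h l)))
  (≡.trans (ℚΣ.anti-+ _ _ n) (≡.cong₂ ℚ._+_ (≡.sym (*F-anti f g n)) (≡.sym (*F-anti f h n)))))

≋-refl : ∀ {f} → f ≋ f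
≋-refl = pointwise λ _ → ≡.refl

≋-sym : ∀ {f g} → f ≋ g → g ≋ f
≋-sym p = pointwise λ n → ≡.sym (coeff p n)

≋-trans : ∀ {f g h} → f ≋ g → g ≋ h → f ≋ h
≋-trans p r = pointwise λ n → ≡.trans (coeff p n) (coeff r n)

fpsRing : CommutativeRing Level.0ℓ Level.0ℓ
fpsRing = record
  { Carrier = FPS ; _≈_ = _≋_ ; _+_ = _+F_ ; _*_ = _*F_ ; -_ = negF ; 0# = zeroF ; 1# = oneF
  ; isCommutativeRing = record
    { isRing = record
      { +-isAbelianGroup = record
        { isGroup = record
          { isMonoid = record
            { isSemigroup = record
              { isMagma = record
                { isEquivalence = record { refl = ≋-refl ; sym = ≋-sym ; trans = ≋-trans }
                ; ∙-cong = λ p r → pointwise λ n → ≡.cong₂ ℚ._+_ (coeff p n) (coeff r n) }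
              ; assoc = λ f g h → pointwise λ n → ℚ.+-assoc (f n) (g n) (h n) }
            ; identity = (λ f → pointwise λ n → ℚ.+-identityˡ (f n)) , (λ f → pointwise λ n → ℚ.+-identityʳ (f n)) }
          ; inverse = (λ f → pointwise λ n → ℚ.+-inverseˡ (f n)) , (λ f → pointwise λ n → ℚ.+-inverseʳ (f n))
          ; ⁻¹-cong = λ p → pointwise λ n → ≡.cong ℚ.-_ (coeff p n) }
        ; comm = λ f g → pointwise λ n → ℚ.+-comm (f n) (g n) }
      ; *-cong = *F-cong
      ; *-assoc = *F-assoc
      ; *-identity = *F-identityˡ , (λ f → ≋-trans (*F-comm f oneF) (*F-identityˡ f))
      ; distrib = *F-distribˡ , (λ f g h → ≋-trans (*F-comm (g +F h) f) (≋-trans (*F-distribˡ f g h)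
          (pointwise λ n → ≡.cong₂ ℚ._+_ (coeff (*F-comm f g) n) (coeff (*F-comm f h) n))))
      }
    ; *-comm = *F-comm } }

monoF : ℚ → ℕ → FPS
monoF a m n = if n ≡ᵇ m then a else 0ℚ

qF : FPS
qF = monoF 1ℚ 1

open PowerCongruence fpsRing qF

qF-* : ∀ f → qF *F f ≋ shiftF 1 f
qF-* f = pointwise λ { zero → ≡.trans (*F-anti qF f 0) (ℚ.*-zeroˡ (f 0))
  ; (suc n) → ≡.trans (*F-anti qF f (suc n)) (≡.trans (≡.cong₂ ℚ._+_ (ℚ.*-zeroˡ (f (suc n))) (≡.sym (*F-anti oneF f n)))
      (≡.trans (ℚ.+-identityˡ _) (coeff (*F-identityˡ f) n))) }

shiftF-suc : ∀ k f → shiftF (suc k) f ≋ shiftF 1 (shiftF k f)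
shiftF-suc k f = pointwise λ { zero → ≡.refl ; (suc n) → ≡.refl }

q^-* : ∀ k f → q^ k *F f ≋ shiftF k f
q^-* zero f = ≋-trans (*F-cong q^-0 (≋-refl {f})) (*F-identityˡ f)
q^-* (suc k) f = ≋-trans (*F-cong (q^-suc k) (≋-refl {f})) (≋-trans (*F-assoc qF (q^ k) f)
  (≋-trans (*F-cong (≋-refl {qF}) (q^-* k f)) (≋-trans (qF-* (shiftF k f)) (≋-sym (shiftF-suc k f)))))

shiftF-one : ∀ k n → shiftF k oneF n ≡ monoF 1ℚ k n
shiftF-one zero    n       = ≡.refl
shiftF-one (suc k) zero    = ≡.refl
shiftF-one (suc k) (suc n) = shiftF-one k n

monoF-q^ : ∀ k → monoF 1ℚ k ≋ q^ k
monoF-q^ k = ≋-trans (pointwise λ n → ≡.sym (shiftF-one k n))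
  (≋-trans (≋-sym (q^-* k oneF)) (≋-trans (*F-comm (q^ k) oneF) (*F-identityˡ (q^ k))))

monoF-neg : ∀ k → monoF (ℚ.- 1ℚ) k ≋ negF (monoF 1ℚ k)
monoF-neg k = pointwise λ n → go (n ≡ᵇ k)
  where
  go : ∀ t → (if t then ℚ.- 1ℚ else 0ℚ) ≡ ℚ.- (if t then 1ℚ else 0ℚ)
  go true  = ≡.refl
  go false = ≡.refl

shiftF-+ : ∀ d f n → shiftF d f (n ℕ.+ d) ≡ f n
shiftF-+ zero    f n = ≡.cong f (ℕ.+-identityʳ n)
shiftF-+ (suc d) f n = ≡.trans (≡.cong (shiftF (suc d) f) (ℕ.+-suc n d)) (shiftF-+ d f n)

shiftF-< : ∀ d f n → n ℕ.< d → shiftF d f n ≡ 0ℚ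
shiftF-< (suc d) f zero    _           = ≡.refl
shiftF-< (suc d) f (suc n) (ℕ.s≤s n<d) = shiftF-< d f n n<d

q^-coeff : ∀ d f n → (q^ d *F f) (n ℕ.+ d) ≡ f n
q^-coeff d f n = ≡.trans (coeff (q^-* d f) (n ℕ.+ d)) (shiftF-+ d f n)

q^-coeff-< : ∀ d f n → n ℕ.< d → (q^ d *F f) n ≡ 0ℚ
q^-coeff-< d f n n<d = ≡.trans (coeff (q^-* d f) n) (shiftF-< d f n n<d)

q^-cancel : ∀ d {f g} → q^ d *F f ≋ q^ d *F g → f ≋ g
q^-cancel d {f} {g} p = pointwise λ n → ≡.trans (≡.sym (q^-coeff d f n)) (≡.trans (coeff p (n ℕ.+ d)) (q^-coeff d g n))

coeff-of-mod : ∀ {f g M} → f ≈ g [mod M ] → ∀ n → n ℕ.< M → f n ≡ g n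
coeff-of-mod {f} {g} {M} (d , e) n n<M =
  ≡.trans (coeff e n) (≡.trans (≡.cong (g n ℚ.+_) (q^-coeff-< M d n n<M)) (ℚ.+-identityʳ (g n)))

mod-of-coeff : ∀ {f g} M → (∀ n → n ℕ.< M → f n ≡ g n) → f ≈ g [mod M ]
mod-of-coeff {f} {g} M h = d , pointwise go
  where
  d : FPS
  -- The quotient is the difference of the two series with indices lowered by M.
  d n = ℚ.- g (n ℕ.+ M) ℚ.+ f (n ℕ.+ M)
  go : ∀ n → f n ≡ g n ℚ.+ (q^ M *F d) n
  go n with n ℕ.<? M
  ... | yes n<M = ≡.trans (h n n<M) (≡.sym (≡.trans (≡.cong (g n ℚ.+_) (q^-coeff-< M d n n<M)) (ℚ.+-identityʳ (g n))))
  ... | no  n≮M = ≡.subst (λ t → f t ≡ g t ℚ.+ (q^ M *F d) t) (ℕ.m∸n+n≡m (ℕ.≮⇒≥ n≮M)) (begin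
    f k                                ≡⟨ ℚ.+-identityˡ (f k) ⟨
    0ℚ ℚ.+ f k                         ≡⟨ ≡.cong (ℚ._+ f k) (ℚ.+-inverseʳ (g k)) ⟨
    (g k ℚ.- g k) ℚ.+ f k              ≡⟨ ℚ.+-assoc (g k) (ℚ.- g k) (f k) ⟩
    g k ℚ.+ d (n ∸ M)                  ≡⟨ ≡.cong (g k ℚ.+_) (q^-coeff M d (n ∸ M)) ⟨
    g k ℚ.+ (q^ M *F d) k              ∎)
    where
    open ≡.≡-Reasoning
    k = n ∸ M ℕ.+ M

-- Stage N of the recursion overwrites coefficient N alone, so later stages leave coefficient m as
-- it was.
invUpto-stable : ∀ f m d → invUpto f (d ℕ.+ m) m ≡ invF f m
invUpto-stable f m zero    = ≡.refl
invUpto-stable f m (suc d) = ≡.trans (skip (m ≡ᵇ suc (d ℕ.+ m)) ≡.refl) (invUpto-stable f m d)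
  where
  differ : ∀ m d → (m ≡ᵇ suc (d ℕ.+ m)) ≡ false
  differ zero    d = ≡.refl
  differ (suc m) d = ≡.trans (≡.cong (m ≡ᵇ_) (ℕ.+-suc d m)) (differ m d)
  skip : ∀ t → (m ≡ᵇ suc (d ℕ.+ m)) ≡ t → invUpto f (suc (d ℕ.+ m)) m ≡ invUpto f (d ℕ.+ m) m
  skip t e rewrite differ m d = ≡.refl

≡ᵇ-refl : ∀ n → (n ≡ᵇ n) ≡ true
≡ᵇ-refl zero    = ≡.refl
≡ᵇ-refl (suc n) = ≡ᵇ-refl n

invF-suc : ∀ f n → invF f (suc n) ≡ ℚ.- ℚΣ.anti (λ j l → f (suc j) ℚ.* invF f l) n
invF-suc f n rewrite ≡ᵇ-refl n = ≡.cong ℚ.-_ (≡.trans (sumBelow-sumTo _ n)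
  (ℚΣ.anti-cong′ n (λ { j l ≡.refl → ≡.cong (f (suc j) ℚ.*_)
    (≡.trans (≡.cong (invUpto f (j ℕ.+ l)) (ℕ.m+n∸m≡n j l)) (invUpto-stable f l j)) })))

invF-inverse : ∀ f → f 0 ≡ 1ℚ → f *F invF f ≋ oneF
invF-inverse f f0 = pointwise λ
  { zero    → ≡.trans (*F-anti f (invF f) 0) (≡.trans (≡.cong (ℚ._* 1ℚ) f0) (ℚ.*-identityˡ 1ℚ))
  ; (suc n) → ≡.trans (*F-anti f (invF f) (suc n)) (≡.trans
      (≡.cong (ℚ._+ tail n) (≡.trans (≡.cong₂ ℚ._*_ f0 (invF-suc f n)) (ℚ.*-identityˡ (ℚ.- tail n))))
      (ℚ.+-inverseˡ (tail n))) }
  where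
  tail : ℕ → ℚ
  tail = ℚΣ.anti (λ j l → f (suc j) ℚ.* invF f l)

invqF : ℕ → FPS
invqF n = invF (oneF +F negF (q^ (suc n)))

q^-coeff-0 : ∀ n → q^ (suc n) 0 ≡ 0ℚ
q^-coeff-0 n = ≡.sym (coeff (monoF-q^ (suc n)) 0)

invqF-law : ∀ n → (oneF +F negF (q^ (suc n))) *F invqF n ≋ oneF
invqF-law n = invF-inverse (oneF +F negF (q^ (suc n))) (≡.cong (λ t → 1ℚ ℚ.+ ℚ.- t) (q^-coeff-0 n))

halfF : FPS
halfF = monoF ½ 0

halfF-law : halfF +F halfF ≋ oneF
halfF-law = pointwise λ { zero → ≡.refl ; (suc n) → ≡.refl }

fpsQRing : QRing Level.0ℓ Level.0ℓ
fpsQRing = record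
  { R = fpsRing ; q = qF ; inv = invqF ; inv-law = invqF-law ; half = halfF ; half-law = halfF-law }

open IntegerSolver fpsRing
open TripleProduct fpsQRing using (poch; poch-stable)
open BaileyChain fpsQRing using (multiSum; multiSum-unit)
open ProductSide fpsQRing using (multiSum-product)
open TupleSum fpsQRing
open InverseFactorial fpsQRing 1 using (iv; fac; fac-iv)
private module F = CommutativeRing fpsRing
open import Relation.Binary.Reasoning.Setoid F.setoid

-- Finite and infinite products of power series.

binF-pos : ∀ k → binF 1ℚ k ≋ oneF +F negF (oneF *F q^ k)
binF-pos k = F.+-congˡ {oneF} (F.trans (monoF-neg k) (F.-‿cong (F.trans (monoF-q^ k) (F.sym (*F-identityˡ (q^ k))))))

binF-neg : ∀ k → binF -ℚ1 k ≋ oneF +F negF (negF oneF *F q^ k)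
binF-neg k = F.+-congˡ {oneF} (F.trans (monoF-q^ k) (solve 1 (λ x → x := :- ((:- :1) :* x)) F.refl (q^ k)))

prodF-∷ʳ : ∀ fs g → prodF (fs ∷ʳ g) ≋ prodF fs *F g
prodF-∷ʳ []       g = F.*-comm g oneF
prodF-∷ʳ (f ∷ fs) g = F.trans (F.*-congˡ {f} (prodF-∷ʳ fs g)) (F.sym (F.*-assoc f (prodF fs) g))

-- `s` is the rational constant `a` as a ring element; the hypothesis links the two, so that a = 1
-- and a = -1 share one proof.
qPochF-poch : ∀ a s → (∀ k → binF a k ≋ oneF +F negF (s *F q^ k)) → ∀ e b m → qPochF a e b m ≋ poch s e b m
qPochF-poch a s h e b zero    = F.refl
qPochF-poch a s h e b (suc m) = begin
  prodF (map g (upTo (suc m)))                 ≡⟨ ≡.cong (λ t → prodF (map g t)) (List.upTo-∷ʳ m) ⟨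
  prodF (map g (upTo m ∷ʳ m))                  ≡⟨ ≡.cong prodF (List.map-++ g (upTo m) (m ∷ [])) ⟩
  prodF (map g (upTo m) ∷ʳ g m)                ≈⟨ prodF-∷ʳ (map g (upTo m)) (g m) ⟩
  prodF (map g (upTo m)) *F g m                ≈⟨ F.*-cong (qPochF-poch a s h e b m) (h (e ℕ.+ b ℕ.* m)) ⟩
  poch s e b (suc m)                           ∎
  where
  g : ℕ → FPS
  g j = binF a (e ℕ.+ b ℕ.* j)

-- Coefficient n of the infinite product is read off n + 1 factors, and by `poch-stable` further
-- factors do not alter it.
qPochInf-mod : ∀ a s → (∀ k → binF a k ≋ oneF +F negF (s *F q^ k)) →
  ∀ e b M N → M ℕ.≤ N → qPochInf a e (suc b) ≈ poch s e (suc b) N [mod M ]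
qPochInf-mod a s h e b M N M≤N = mod-of-coeff M λ n n<M →
  ≡.trans (coeff (qPochF-poch a s h e (suc b) (suc n)) n)
    (≡.sym (≡.subst (λ t → poch s e (suc b) t n ≡ poch s e (suc b) (suc n) n) (ℕ.m+[n∸m]≡n (ℕ.≤-trans n<M M≤N))
      (coeff-of-mod (poch-stable s e b (suc n) (N ∸ suc n)) n (ℕ.n<1+n n))))

multiSum-RHS : ∀ m j M → multiSum m j M ≈ RHS (suc (j ℕ.+ m)) (suc j) [mod M ]
multiSum-RHS m j M = mod-trans
  (mod-of-≈ (F.trans (F.sym (F.*-identityʳ L)) (F.trans (F.*-congˡ {L} (F.sym (invF-inverse E ≡.refl))) (F.sym (F.*-assoc L E E⁻¹)))))
  (mod-trans (mod-* (mod-trans (mod-*ˡ L (pos 1 0 (M ℕ.+ M) (ℕ.m≤m+n M M))) (multiSum-product m j M)) (mod-refl {E⁻¹}))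
  (mod-trans (mod-of-≈ (solve 5 (λ a x y z e → a :* (x :* (y :* z)) :* e := a :* (x :* (y :* (z :* e)))) F.refl A X Y Q E⁻¹))
  (mod-sym (mod-* (qPochInf-mod -ℚ1 (negF oneF) binF-neg 1 0 M (M ℕ.+ M) (ℕ.m≤m+n M M))
    (mod-* (exps (first j) (third m j) M ℕ.≤-refl)
    (mod-* (exps (second m j) (third m j) M ℕ.≤-refl)
    (mod-* (exps (third m j) (third m j) (M ℕ.+ M) (ℕ.m≤m+n M M)) (mod-refl {E⁻¹}))))))))
  where
  b : ℕ
  b = j ℕ.+ j ℕ.+ suc (j ℕ.+ j ℕ.+ 4 ℕ.* m)
  L E E⁻¹ A X Y Q : FPS
  A   = poch (negF oneF) 1 1 (M ℕ.+ M)
  X   = poch oneF (suc (j ℕ.+ j)) (suc b) M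
  Y   = poch oneF (suc (j ℕ.+ j ℕ.+ 4 ℕ.* m)) (suc b) M
  Q   = poch oneF (suc b) (suc b) (M ℕ.+ M)
  L   = multiSum m j M
  E   = qPochInf 1ℚ 1 1
  E⁻¹ = invF E
  pos : ∀ e b N → M ℕ.≤ N → qPochInf 1ℚ e (suc b) ≈ poch oneF e (suc b) N [mod M ]
  pos e b N = qPochInf-mod 1ℚ oneF binF-pos e b M N
  exps : ∀ {e e′ B b} → e ≡ e′ → B ≡ suc b → ∀ N → M ℕ.≤ N → qPochInf 1ℚ e B ≈ poch oneF e′ (suc b) N [mod M ]
  exps {e} {b = b′} ≡.refl ≡.refl = pos e b′
  first : ∀ j → 2 ℕ.* suc j ∸ 1 ≡ suc (j ℕ.+ j)
  first j = ≡.cong (_∸ 1) (double j)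
    where
    double : ∀ j → 2 ℕ.* suc j ≡ 2 ℕ.+ (j ℕ.+ j)
    double = solve-∀
  second : ∀ m j → 4 ℕ.* suc (j ℕ.+ m) ∸ 1 ∸ 2 ℕ.* suc j ≡ suc (j ℕ.+ j ℕ.+ 4 ℕ.* m)
  second m j = ≡.trans (≡.cong (λ t → t ∸ 1 ∸ 2 ℕ.* suc j) (split m j)) (ℕ.m+n∸m≡n (2 ℕ.* suc j) _)
    where
    split : ∀ m j → 4 ℕ.* suc (j ℕ.+ m) ≡ suc (2 ℕ.* suc j ℕ.+ suc (j ℕ.+ j ℕ.+ 4 ℕ.* m))
    split = solve-∀
  third : ∀ m j → 4 ℕ.* suc (j ℕ.+ m) ∸ 2 ≡ suc (j ℕ.+ j ℕ.+ suc (j ℕ.+ j ℕ.+ 4 ℕ.* m))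
  third m j = ≡.cong (_∸ 2) (split m j)
    where
    split : ∀ m j → 4 ℕ.* suc (j ℕ.+ m) ≡ 3 ℕ.+ (j ℕ.+ j ℕ.+ suc (j ℕ.+ j ℕ.+ 4 ℕ.* m))
    split = solve-∀

-- From Laurent series to power series.

-- L represents q^(-A) f.
record Represents (L : Laurent) (A : ℕ) (f : FPS) : Set where
  constructor represents
  field shifted : q^ A *F series L ≋ q^ (negDeg L) *F f
open Represents

rep-ofFPS : ∀ f → Represents (ofFPS f) 0 f
rep-ofFPS f = represents F.refl

rep-cong : ∀ {L A B f g} → A ≡ B → f ≋ g → Represents L A f → Represents L B g
rep-cong {L} ≡.refl p r = represents (F.trans (shifted r) (F.*-congˡ {q^ (negDeg L)} p))

rep-* : ∀ {L₁ L₂ A₁ A₂ f₁ f₂} → Represents L₁ A₁ f₁ → Represents L₂ A₂ f₂ → Represents (L₁ *L L₂) (A₁ ℕ.+ A₂) (f₁ *F f₂)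
rep-* {L₁} {L₂} {A₁} {A₂} {f₁} {f₂} r₁ r₂ = represents (begin
  q^ (A₁ ℕ.+ A₂) *F (series L₁ *F series L₂)                       ≈⟨ F.*-congʳ {series L₁ *F series L₂} (q^-+ A₁ A₂) ⟩
  (q^ A₁ *F q^ A₂) *F (series L₁ *F series L₂)                     ≈⟨ swap (q^ A₁) (q^ A₂) (series L₁) (series L₂) ⟩
  (q^ A₁ *F series L₁) *F (q^ A₂ *F series L₂)                     ≈⟨ F.*-cong (shifted r₁) (shifted r₂) ⟩
  (q^ (negDeg L₁) *F f₁) *F (q^ (negDeg L₂) *F f₂)                 ≈⟨ swap (q^ (negDeg L₁)) (q^ (negDeg L₂)) f₁ f₂ ⟨
  (q^ (negDeg L₁) *F q^ (negDeg L₂)) *F (f₁ *F f₂)                 ≈⟨ F.*-congʳ {f₁ *F f₂} (q^-+ (negDeg L₁) (negDeg L₂)) ⟨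
  q^ (negDeg L₁ ℕ.+ negDeg L₂) *F (f₁ *F f₂)                       ∎)
  where
  swap : ∀ a b c d → (a *F b) *F (c *F d) ≋ (a *F c) *F (b *F d)
  swap = solve 4 (λ a b c d → (a :* b) :* (c :* d) := (a :* c) :* (b :* d)) F.refl

rep-cancel : ∀ {L f} A → Represents L A (q^ A *F f) → Represents L 0 f
rep-cancel {L} {f} A r = represents (F.trans (F.trans (F.*-congʳ {series L} q^-0) (*F-identityˡ (series L)))
  (q^-cancel A (F.trans (shifted r) (solve 3 (λ a b c → a :* (b :* c) := b :* (a :* c)) F.refl (q^ (negDeg L)) (q^ A) f))))

rep-series : ∀ {L f} → Represents L 0 f → series L ≋ q^ (negDeg L) *F f
rep-series {L} r = F.trans (F.sym (F.trans (F.*-congʳ {series L} q^-0) (*F-identityˡ (series L)))) (shifted r)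

rep-+ : ∀ {L₁ L₂ f₁ f₂} → Represents L₁ 0 f₁ → Represents L₂ 0 f₂ → Represents (L₁ +L L₂) 0 (f₁ +F f₂)
rep-+ {L₁} {L₂} {f₁} {f₂} r₁ r₂ = represents (begin
  q^ 0 *F (shiftF (D ∸ negDeg L₁) (series L₁) +F shiftF (D ∸ negDeg L₂) (series L₂))
    ≈⟨ F.trans (F.*-congʳ {shiftF (D ∸ negDeg L₁) (series L₁) +F shiftF (D ∸ negDeg L₂) (series L₂)} q^-0) (*F-identityˡ _) ⟩
  shiftF (D ∸ negDeg L₁) (series L₁) +F shiftF (D ∸ negDeg L₂) (series L₂)
    ≈⟨ F.+-cong (raise r₁ (ℕ.m≤m⊔n (negDeg L₁) (negDeg L₂))) (raise r₂ (ℕ.m≤n⊔m (negDeg L₁) (negDeg L₂))) ⟩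
  (q^ D *F f₁) +F (q^ D *F f₂)
    ≈⟨ *F-distribˡ (q^ D) f₁ f₂ ⟨
  q^ D *F (f₁ +F f₂) ∎)
  where
  D = negDeg L₁ ⊔ negDeg L₂
  raise : ∀ {L f} → Represents L 0 f → negDeg L ℕ.≤ D → shiftF (D ∸ negDeg L) (series L) ≋ q^ D *F f
  raise {L} {f} r d≤D = begin
    shiftF (D ∸ negDeg L) (series L)                       ≈⟨ q^-* (D ∸ negDeg L) (series L) ⟨
    q^ (D ∸ negDeg L) *F series L                          ≈⟨ F.*-congˡ {q^ (D ∸ negDeg L)} (rep-series r) ⟩
    q^ (D ∸ negDeg L) *F (q^ (negDeg L) *F f)              ≈⟨ F.*-assoc (q^ (D ∸ negDeg L)) (q^ (negDeg L)) f ⟨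
    (q^ (D ∸ negDeg L) *F q^ (negDeg L)) *F f              ≈⟨ F.*-congʳ {f} (F.trans (F.sym (q^-+ (D ∸ negDeg L) (negDeg L))) (q^-cong (ℕ.m∸n+n≡m d≤D))) ⟩
    q^ D *F f                                              ∎

rep-binL : ∀ t → Represents (binL -ℚ1 -[1+ t ]) (suc t) (oneF +F q^ (suc t))
rep-binL t = represents (F.*-congˡ {q^ (suc t)} (begin
  shiftF (suc t) oneF +F shiftF (t ∸ t) oneF    ≡⟨ ≡.cong (λ d → shiftF (suc t) oneF +F shiftF d oneF) (ℕ.n∸n≡0 t) ⟩
  shiftF (suc t) oneF +F oneF                   ≈⟨ F.+-comm (shiftF (suc t) oneF) oneF ⟩
  oneF +F shiftF (suc t) oneF                   ≈⟨ F.+-congˡ {oneF} (F.trans (pointwise (shiftF-one (suc t))) (monoF-q^ (suc t))) ⟩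
  oneF +F q^ (suc t)                            ∎))

-- The exponents rise by 2 from -(o + 2n - 1) to -(o + 1). In the offset form required of `h`,
-- dropping the first factor lowers n by one and keeps the shape.
rep-negProd : ∀ o n (h : ℕ → ℤ) → (∀ j → h j ≡ (2 ℕ.* suc j) ℤ.⊖ (suc o ℕ.+ 2 ℕ.* n)) →
  Represents (prodL (applyUpTo (λ j → binL -ℚ1 (h j)) n)) (lowest (suc o) n) (negProd (suc o) n)
rep-negProd o zero    h h-def = rep-ofFPS oneF
rep-negProd o (suc n) h h-def = rep-*
  (≡.subst (λ z → Represents (binL -ℚ1 z) (suc o ℕ.+ 2 ℕ.* n) (oneF +F q^ (suc o ℕ.+ 2 ℕ.* n))) (≡.sym head) (rep-binL (o ℕ.+ 2 ℕ.* n)))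
  (rep-negProd o n (λ j → h (suc j)) tail)
  where
  exponent : ∀ o n → suc o ℕ.+ 2 ℕ.* suc n ≡ 2 ℕ.+ (suc o ℕ.+ 2 ℕ.* n)
  exponent = solve-∀
  head : h 0 ≡ -[1+ o ℕ.+ 2 ℕ.* n ]
  head = ≡.trans (h-def 0) (≡.cong (2 ℤ.⊖_) (exponent o n))
  tail : ∀ j → h (suc j) ≡ (2 ℕ.* suc j) ℤ.⊖ (suc o ℕ.+ 2 ℕ.* n)
  tail j = ≡.trans (h-def (suc j)) (≡.trans (≡.cong₂ ℤ._⊖_ (ℕ.*-suc 2 (suc j)) (exponent o n))
    (≡.trans (ℤ.[1+m]⊖[1+n]≡m⊖n (suc (2 ℕ.* suc j)) (suc (suc o ℕ.+ 2 ℕ.* n)))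
              (ℤ.[1+m]⊖[1+n]≡m⊖n (2 ℕ.* suc j) (suc o ℕ.+ 2 ℕ.* n))))

rep-evenProd : ∀ N → Represents (qPoch -ℚ1 (+ 2 ℤ.- + (2 ℕ.* N)) 2 (+ N ℤ.- + 1)) (evenLowest N) (evenProd N)
-- The index is -1 here: the symbol is the inverse of 1 + q^0, and `recip` computes to ½.
rep-evenProd zero = rep-cong ≡.refl (F.*-identityʳ halfF) (rep-* (rep-ofFPS halfF) (rep-ofFPS oneF))
rep-evenProd (suc n) = ≡.subst (λ t → Represents (prodL t) (lowest 2 n) (negProd 2 n)) (≡.sym (List.map-upTo _ n))
  (rep-negProd 1 n _ λ j → ≡.trans (≡.cong (ℤ._+ + (2 ℕ.* j)) (ℤ.m-n≡m⊖n 2 (2 ℕ.* suc n)))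
    (≡.trans (ℤ.distribˡ-⊖-+-pos (2 ℕ.* j) 2 (2 ℕ.* suc n)) (≡.cong₂ ℤ._⊖_ (≡.sym (ℕ.*-suc 2 j)) (ℕ.*-suc 2 n))))

rep-oddProd : ∀ N → Represents (qPoch -ℚ1 (+ 1 ℤ.- + (2 ℕ.* N)) 2 (+ N)) (lowest 1 N) (negProd 1 N)
rep-oddProd N = ≡.subst (λ t → Represents (prodL t) (lowest 1 N) (negProd 1 N)) (≡.sym (List.map-upTo _ N))
  (rep-negProd 0 N _ λ j → ≡.trans (≡.cong (ℤ._+ + (2 ℕ.* j)) (ℤ.m-n≡m⊖n 1 (2 ℕ.* N)))
    (≡.trans (ℤ.distribˡ-⊖-+-pos (2 ℕ.* j) 1 (2 ℕ.* N))
    (≡.trans (≡.sym (ℤ.[1+m]⊖[1+n]≡m⊖n (1 ℕ.+ 2 ℕ.* j) (2 ℕ.* N))) (≡.cong (ℤ._⊖ (1 ℕ.+ 2 ℕ.* N)) (≡.sym (ℕ.*-suc 2 j))))))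

rep-monoL : ∀ m → Represents (monoL 1ℚ (+ m)) 0 (q^ m)
rep-monoL m = rep-cong ≡.refl (monoF-q^ m) (rep-ofFPS (monoF 1ℚ m))

-- Both sides invert the same product, and inverses are unique.
invF-qPochF : ∀ n → invF (qPochF 1ℚ 2 2 n) ≋ iv n
invF-qPochF n = begin
  I                        ≈⟨ *F-identityˡ I ⟨
  oneF *F I                ≈⟨ F.*-congʳ {I} (fac-iv n) ⟨
  (fac n *F iv n) *F I     ≈⟨ solve 3 (λ a b c → a :* b :* c := b :* (a :* c)) F.refl (fac n) (iv n) I ⟩
  iv n *F (fac n *F I)     ≈⟨ F.*-congˡ {iv n} (F.trans (F.*-congʳ {I} fac-Q) (invF-inverse Q Q0)) ⟩
  iv n *F oneF             ≈⟨ F.*-identityʳ (iv n) ⟩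
  iv n                     ∎
  where
  open TripleProduct.Theta fpsQRing 1 0 0 ≡.refl using (fac-poch)
  Q I : FPS
  Q = qPochF 1ℚ 2 2 n
  I = invF Q
  Q-poch : Q ≋ poch oneF 2 2 n
  Q-poch = qPochF-poch 1ℚ oneF binF-pos 2 2 n
  fac-Q : fac n ≋ Q
  fac-Q = F.trans (fac-poch n) (F.sym Q-poch)
  Q0 : Q 0 ≡ 1ℚ
  Q0 = ≡.trans (coeff Q-poch 0) (poch-0 n)
    where
    poch-0 : ∀ n → poch oneF 2 2 n 0 ≡ 1ℚ
    poch-0 zero    = ≡.refl
    poch-0 (suc n) = ≡.trans (*F-anti (poch oneF 2 2 n) (oneF +F negF (oneF *F q^ (2 ℕ.+ 2 ℕ.* n))) 0)
      (≡.cong₂ (λ a b → a ℚ.* (1ℚ ℚ.- b)) (poch-0 n)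
        (≡.trans (coeff (*F-identityˡ (q^ (2 ℕ.+ 2 ℕ.* n))) 0) (q^-coeff-0 (1 ℕ.+ 2 ℕ.* n))))

quotientF : ℕ → List ℕ → FPS
quotientF N as = prodF (map (λ j → invF (qPochF 1ℚ 2 2 (nth (N ∷ as) j ∸ nth (N ∷ as) (suc j)))) (map suc (upTo (suc (length as)))))

quotientF-denominator : ∀ N as → quotientF N as ≋ denominator N as
quotientF-denominator N as = F.trans (F.reflexive (≡.cong prodF (≡.trans (≡.cong (map (factor N as)) (List.map-upTo suc (suc (length as))))
                                                                     (List.map-applyUpTo suc (factor N as) (suc (length as)))))) (go N as)
  where
  factor : ℕ → List ℕ → ℕ → FPS
  factor N as j = invF (qPochF 1ℚ 2 2 (nth (N ∷ as) j ∸ nth (N ∷ as) (suc j)))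
  go : ∀ N as → prodF (applyUpTo (λ j → factor N as (suc j)) (suc (length as))) ≋ denominator N as
  go N []       = F.trans (F.*-identityʳ (factor N [] 1)) (invF-qPochF N)
  go N (a ∷ as) = F.*-cong (invF-qPochF (N ∸ a)) (go a as)

-- The negative powers of the two numerator symbols add up to a power that `tupleTerm-monomial` also
-- exhibits as a factor; cancelling it shows the summand to be a power series.
rep-summand : ∀ i′ N as → Represents (summand (suc (suc (length as))) (suc i′) (N ∷ as)) 0 (tupleTerm i′ (N ∷ as))
rep-summand i′ N as = rep-cancel (evenLowest N ℕ.+ lowest 1 N)
  (rep-cong (≡.cong (evenLowest N ℕ.+_) (ℕ.+-identityʳ (lowest 1 N)))
    (F.trans (F.*-congˡ {evenProd N} (F.*-congˡ {negProd 1 N} (F.*-congˡ {q^ e} (F.*-congˡ {oneF +F q^ f} (quotientF-denominator N as)))))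
             (tupleTerm-monomial i′ N as))
    (rep-* (rep-evenProd N) (rep-* (rep-oddProd N) (rep-* (rep-monoL e)
      (rep-* (rep-+ (rep-ofFPS oneF) (rep-monoL f)) (rep-ofFPS (quotientF N as)))))))
  where
  e = 2 ℕ.* (squares (N ∷ as) ℕ.+ sum (drop (suc i′) (N ∷ as)))
  f = 2 ℕ.* nth (N ∷ as) (suc i′)

decTuples-length : ∀ n M → All (λ Ns → length Ns ≡ n) (decTuples n M)
decTuples-length zero    M = ≡.refl ∷ []
decTuples-length (suc n) M = All.concat⁺ (All.map⁺ (All.universal
  (λ a → All.map⁺ (All.map (≡.cong suc) (decTuples-length n a))) (upTo (suc M))))

rep-sumL : ∀ n i′ Nss → All (λ Ns → length Ns ≡ suc n) Nss →
  Represents (sumL (map (summand (suc (suc n)) (suc i′)) Nss)) 0 (sumList (tupleTerm i′) Nss)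
rep-sumL n i′ []               []            = rep-ofFPS zeroF
rep-sumL n i′ ((N ∷ as) ∷ Nss) (≡.refl ∷ hs) = rep-+ (rep-summand i′ N as) (rep-sumL n i′ Nss hs)

rep-partialLHS : ∀ k i′ → i′ ℕ.≤ k → ∀ M → Represents (partialLHS (suc k) (suc i′) M) 0 (multiSum (k ∸ i′) i′ M)
-- For k = 1 only the empty tuple occurs; `nth` reads N₁ = 0 from it, and the single term is ½ · 2.
rep-partialLHS zero zero _ M = rep-cong ≡.refl
  (F.trans (F.+-identityʳ unit) (F.trans unit≋1 (F.sym (multiSum-unit M))))
  (rep-+ (rep-* (rep-evenProd 0) (rep-* (rep-oddProd 0) (rep-* (rep-monoL 0)
    (rep-* (rep-+ (rep-ofFPS oneF) (rep-monoL 0)) (rep-ofFPS oneF))))) (rep-ofFPS zeroF))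
  where
  unit : FPS
  unit = halfF *F (oneF *F (q^ 0 *F ((oneF +F q^ 0) *F oneF)))
  unit≋1 : unit ≋ oneF
  unit≋1 = F.trans (F.*-congˡ {halfF} (F.*-congˡ {oneF} (F.*-cong q^-0 (F.*-congʳ {oneF} (F.+-congˡ {oneF} q^-0)))))
    (F.trans (solve 1 (λ h → h :* (:1 :* (:1 :* ((:1 :+ :1) :* :1))) := h :+ h) F.refl halfF) halfF-law)
rep-partialLHS (suc n) i′ i′≤ M = rep-cong ≡.refl (sumList-tupleTerm n i′ i′≤ M)
  (rep-sumL n i′ (decTuples (suc n) M) (decTuples-length (suc n) M))

coeffL-rep : ∀ {L f} → Represents L 0 f → ∀ n → coeffL L (+ n) ≡ f n
coeffL-rep {L} {f} r n = ≡.trans (coeff (rep-series r) (n ℕ.+ negDeg L)) (q^-coeff (negDeg L) f n)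

-- The shifted index either lies below `negDeg L`, where q^(negDeg L) f has no terms, or is
-- negative, where `coeffL` returns 0.
coeffL-rep-neg : ∀ {L f} → Represents L 0 f → ∀ n → coeffL L -[1+ n ] ≡ 0ℚ
coeffL-rep-neg {L} {f} r n with suc n ℕ.≤? negDeg L
... | yes n<d rewrite ℤ.⊖-≥ n<d = ≡.trans (coeff (rep-series r) (negDeg L ∸ suc n))
  (q^-coeff-< (negDeg L) f (negDeg L ∸ suc n) (ℕ.∸-monoʳ-< (ℕ.s≤s ℕ.z≤n) n<d))
... | no n≮d rewrite ℤ.⊖-< (ℕ.≰⇒> n≮d) with suc n ∸ negDeg L in e
...   | zero  = contradiction (ℕ.m∸n≡0⇒m≤n e) n≮d
...   | suc _ = ≡.refl

theorem1p8 : (k i : ℕ) → 1 ≤ i → i ≤ k → (n : ℤ) →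
    ∃[ M ] ((M′ : ℕ) → M ≤ M′ → coeffL (partialLHS k i M′) n ≡ coeffL (ofFPS (RHS k i)) n)
-- A congruence modulo q^M fixes the coefficients below M, so M = n + 1 is enough for coefficient n.
theorem1p8 (suc k) (suc j) _ (ℕ.s≤s j≤k) (+ n) = suc n , λ M n<M → ≡.trans
  (coeffL-rep (rep-partialLHS k j j≤k M) n)
  (≡.trans (coeff-of-mod (≡.subst (λ t → multiSum (k ∸ j) j M ≈ RHS (suc t) (suc j) [mod M ]) (ℕ.m+[n∸m]≡n j≤k) (multiSum-RHS (k ∸ j) j M)) n n<M)
    (≡.sym (coeffL-rep (rep-ofFPS (RHS (suc k) (suc j))) n)))
theorem1p8 (suc k) (suc j) _ (ℕ.s≤s j≤k) -[1+ n ] = 0 , λ M _ → ≡.trans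
  (coeffL-rep-neg (rep-partialLHS k j j≤k M) n)
  (≡.sym (coeffL-rep-neg (rep-ofFPS (RHS (suc k) (suc j))) n))
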